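{- The generating function $A(q)=\sum_{n\ge1}a(n)q^n$ admits the factorization $$A(q)=P(q)\,S(q),$$ where $$S(q)=\sum_{r=1}^\infty(-1)^{T_{r-1}}\,T_{\lceil r/2\rceil}\,q^{T_{r+1}}.$$
   Context: For a positive integer $n$, $a(n)$ is the signed number of partitions of $n$ into exactly two distinct part sizes, each occurring an odd number of times: $$a(n)=\sum (-1)^{r_1+r_2},$$ the sum being over all quadruples of integers $(x,y,r_1,r_2)$ with $1\le x<y$, $r_1,r_2\ge 0$ and $(2r_1+1)x+(2r_2+1)y=n$. Equivalently, $$A(q)=\sum_{n\ge1}a(n)q^n=\sum_{1\le n_1<n_2}\frac{q^{n_1}}{1+q^{2n_1}}\cdot\frac{q^{n_2}}{1+q^{2n_2}}.$$ For $|q|<1$, $(a;q)_\infty=\prod_{n=0}^\infty(1-aq^n)$. The series $P(q)$ is $$P(q)=\sum_{n\ge0}\mathrm{pod}(n)q^n=\frac{(-q;q^2)_\infty}{(q^2;q^2)_\infty}=\frac{(q^2;q^2)_\infty}{(q;q)_\infty(q^4;q^4)_\infty},$$ where $\mathrm{pod}(n)$ is the number of partitions of $n$ in which odd parts are distinct (even parts are unrestricted). $T_n=n(n+1)/2$ denotes the $n$-th triangular number. Identities may be read as identities of formal power series in $q$, or for $|q|<1$. -}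

module Defs where

open import Data.Integer.Base as ℤ using (ℤ; +_; 0ℤ; -1ℤ)
open import Data.List.Base using (List; []; _∷_; map; foldr; filter; length; upTo; cartesianProduct; cartesianProductWith)
open import Data.List.Membership.Propositional using (_∈_)
open import Data.List.Membership.Propositional.Properties using (∈-filter⁺; ∈-filter⁻; ∈-upTo⁺; ∈-map⁺; ∈-map⁻; ∈-cartesianProduct⁺; ∈-cartesianProductWith⁺; ∈-cartesianProductWith⁻)
open import Data.List.Properties using (∷-injective)
open import Data.List.Relation.Unary.All as All using (All; []; _∷_)
open import Data.List.Relation.Unary.AllPairs using ([]; _∷_)
open import Data.List.Relation.Unary.Any using (here; there)
open import Data.List.Relation.Unary.Linked using (Linked; linked?)
open import Data.List.Relation.Unary.Unique.Propositional using (Unique)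
open import Data.List.Relation.Unary.Unique.Propositional.Properties using (filter⁺; upTo⁺; map⁺; cartesianProduct⁺; cartesianProductWith⁺)
open import Data.Nat.Base using (ℕ; zero; suc; _+_; _*_; _∸_; _/_; _≤_; _≥_; _<_; ⌈_/2⌉; s≤s; z≤n)
open import Data.Nat.Divisibility using (_∣_; _∣?_)
open import Data.Nat.DivMod using (/-monoˡ-≤; m*n/n≡m)
open import Data.Nat.ListAction using (sum)
open import Data.Nat.Properties
open import Data.Product.Base using (_×_; _,_; proj₁; proj₂)
open import Function.Base using (_∘_)
open import Function.Bundles using (_⇔_; mk⇔)
open import Relation.Binary.PropositionalEquality using (_≡_; refl; subst)
open import Relation.Nullary using (¬_; Dec; ¬?; _×-dec_)
import Data.List.Relation.Unary.Unique.DecPropositional as DecUnique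

-- The formal power series Σ f(n) qⁿ is represented by its coefficient function f;
-- equality of series is pointwise equality _≗_.
PowerSeries : Set
PowerSeries = ℕ → ℤ

sumℤ : List ℤ → ℤ
sumℤ = foldr ℤ._+_ 0ℤ

infixl 7 _⊛_

_⊛_ : PowerSeries → PowerSeries → PowerSeries
(f ⊛ g) n = sumℤ (map (λ i → f i ℤ.* g (n ∸ i)) (upTo (suc n)))

Quadruple : Set
Quadruple = ℕ × ℕ × ℕ × ℕ

IsSolution : ℕ → Quadruple → Set
IsSolution n (x , y , r₁ , r₂) =
  1 ≤ x × x < y × (2 * r₁ + 1) * x + (2 * r₂ + 1) * y ≡ n

isSolution? : ∀ n t → Dec (IsSolution n t)
isSolution? n (x , y , r₁ , r₂) =
  (1 ≤? x) ×-dec (x <? y) ×-dec ((2 * r₁ + 1) * x + (2 * r₂ + 1) * y ≟ n)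

box : ℕ → List Quadruple
box n = cartesianProduct r (cartesianProduct r (cartesianProduct r r))
  where r = upTo (suc n)

-- Restricting to the box 0 ≤ x , y , r₁ , r₂ ≤ n loses no solution: see ∈-solutions
-- (and solutions-unique: no solution is listed twice).
solutions : ℕ → List Quadruple
solutions n = filter (isSolution? n) (box n)

sign : Quadruple → ℤ
sign (x , y , r₁ , r₂) = -1ℤ ℤ.^ (r₁ + r₂)

a : ℕ → ℤ
a n = sumℤ (map sign (solutions n))

A : PowerSeries
A zero    = 0ℤ
A (suc n) = a (suc n)

IsPartition : ℕ → List ℕ → Set
IsPartition n ps = Linked _≥_ ps × All (1 ≤_) ps × sum ps ≡ n

isPartition? : ∀ n ps → Dec (IsPartition n ps)
isPartition? n ps = linked? _≥?_ ps ×-dec All.all? (1 ≤?_) ps ×-dec (sum ps ≟ n)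

Odd : ℕ → Set
Odd p = ¬ 2 ∣ p

odd? : ∀ p → Dec (Odd p)
odd? p = ¬? (2 ∣? p)

OddPartsDistinct : List ℕ → Set
OddPartsDistinct ps = Unique (filter odd? ps)

oddPartsDistinct? : ∀ ps → Dec (OddPartsDistinct ps)
oddPartsDistinct? ps = DecUnique.unique? _≟_ (filter odd? ps)

-- All words of length at most l over the alphabet xs.
words : {X : Set} → List X → ℕ → List (List X)
words xs zero    = [] ∷ []
words xs (suc l) = [] ∷ cartesianProductWith _∷_ xs (words xs l)

-- A partition of n has at most n parts, each at most n: see ∈-podPartitions
-- (and podPartitions-unique).
podPartitions : ℕ → List (List ℕ)
podPartitions n =
  filter (λ ps → isPartition? n ps ×-dec oddPartsDistinct? ps) (words (upTo (suc n)) n)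

pod : ℕ → ℕ
pod n = length (podPartitions n)

P : PowerSeries
P n = + pod n

T : ℕ → ℕ
T n = (n * (n + 1)) / 2

-- The indices r ≥ 1 with T (r + 1) ≡ n; all of them are at most n: see ∈-indices
-- (and indices-unique).
indices : ℕ → List ℕ
indices n = filter (λ r → T (r + 1) ≟ n) (map suc (upTo n))

S : PowerSeries
S n = sumℤ (map (λ r → -1ℤ ℤ.^ T (r ∸ 1) ℤ.* + T ⌈ r /2⌉) (indices n))

private
  r≤[2r+1]*x : ∀ r x → 1 ≤ x → r ≤ (2 * r + 1) * x
  r≤[2r+1]*x r (suc x) _ =
    ≤-trans (m≤m+n r (r + 0)) (≤-trans (m≤m+n (2 * r) 1) (m≤m*n (2 * r + 1) (suc x)))

  x≤[2r+1]*x : ∀ r x → x ≤ (2 * r + 1) * x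
  x≤[2r+1]*x r x = subst (λ k → x ≤ k * x) (+-comm 1 (2 * r)) (m≤m+n x (2 * r * x))

∈-solutions : ∀ n t → t ∈ solutions n ⇔ IsSolution n t
∈-solutions n t@(x , y , r₁ , r₂) = mk⇔ (proj₂ ∘ ∈-filter⁻ (isSolution? n) {xs = box n}) complete
  where
  complete : IsSolution n t → t ∈ solutions n
  complete s@(1≤x , x<y , refl) = ∈-filter⁺ (isSolution? n)
    (∈-cartesianProduct⁺ (left (x≤[2r+1]*x r₁ x))
    (∈-cartesianProduct⁺ (right (x≤[2r+1]*x r₂ y))
    (∈-cartesianProduct⁺ (left (r≤[2r+1]*x r₁ x 1≤x))
                         (right (r≤[2r+1]*x r₂ y (≤-trans 1≤x (<⇒≤ x<y))))))) s
    where
    left : ∀ {k} → k ≤ (2 * r₁ + 1) * x → k ∈ upTo (suc n)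
    left p = ∈-upTo⁺ (s≤s (≤-trans p (m≤m+n _ _)))
    right : ∀ {k} → k ≤ (2 * r₂ + 1) * y → k ∈ upTo (suc n)
    right p = ∈-upTo⁺ (s≤s (≤-trans p (m≤n+m _ _)))

solutions-unique : ∀ n → Unique (solutions n)
solutions-unique n = filter⁺ (isSolution? n)
  (cartesianProduct⁺ u (cartesianProduct⁺ u (cartesianProduct⁺ u u)))
  where u = upTo⁺ (suc n)

private
  ∈-words : ∀ {X : Set} {xs : List X} {ws} l →
            All (_∈ xs) ws → length ws ≤ l → ws ∈ words xs l
  ∈-words zero    []       _       = here refl
  ∈-words (suc l) []       _       = here refl
  ∈-words (suc l) (p ∷ ps) (s≤s q) = there (∈-cartesianProductWith⁺ _∷_ p (∈-words l ps q))

  words-unique : ∀ {X : Set} {xs : List X} l → Unique xs → Unique (words xs l)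
  words-unique zero    u = [] ∷ []
  words-unique {xs = xs} (suc l) u =
    All.tabulate nonempty ∷ cartesianProductWith⁺ _∷_ ∷-injective u (words-unique l u)
    where
    nonempty : ∀ {w} → w ∈ cartesianProductWith _∷_ xs (words xs l) → ¬ [] ≡ w
    nonempty w∈ refl with ∈-cartesianProductWith⁻ _∷_ xs (words xs l) w∈
    ... | _ , _ , _ , _ , ()

  length≤sum : ∀ {ps} → All (1 ≤_) ps → length ps ≤ sum ps
  length≤sum []       = z≤n
  length≤sum (p ∷ ps) = +-mono-≤ p (length≤sum ps)

  parts≤sum : ∀ ps → All (_≤ sum ps) ps
  parts≤sum []       = []
  parts≤sum (p ∷ ps) = m≤m+n p _ ∷ All.map (λ q → ≤-trans q (m≤n+m _ p)) (parts≤sum ps)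

∈-podPartitions : ∀ n ps → ps ∈ podPartitions n ⇔ (IsPartition n ps × OddPartsDistinct ps)
∈-podPartitions n ps = mk⇔ (proj₂ ∘ ∈-filter⁻ pod? {xs = words (upTo (suc n)) n}) complete
  where
  pod? : ∀ qs → Dec (IsPartition n qs × OddPartsDistinct qs)
  pod? qs = isPartition? n qs ×-dec oddPartsDistinct? qs
  complete : IsPartition n ps × OddPartsDistinct ps → ps ∈ podPartitions n
  complete s@((_ , pos , refl) , _) = ∈-filter⁺ pod?
    (∈-words n (All.map (∈-upTo⁺ ∘ s≤s) (parts≤sum ps)) (length≤sum pos)) s

podPartitions-unique : ∀ n → Unique (podPartitions n)
podPartitions-unique n = filter⁺ _ (words-unique n (upTo⁺ (suc n)))

private
  r≤T[r+1] : ∀ r → r ≤ T (r + 1)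
  r≤T[r+1] r = subst (_≤ T (r + 1)) (m*n/n≡m r 2)
    (/-monoˡ-≤ 2 (*-mono-≤ (m≤m+n r 1) (+-monoˡ-≤ 1 (m≤n+m 1 r))))

∈-indices : ∀ n r → r ∈ indices n ⇔ (1 ≤ r × T (r + 1) ≡ n)
∈-indices n r = mk⇔ sound complete
  where
  sound : r ∈ indices n → 1 ≤ r × T (r + 1) ≡ n
  sound r∈ with ∈-filter⁻ (λ r → T (r + 1) ≟ n) {xs = map suc (upTo n)} r∈
  ... | r∈′ , eq with ∈-map⁻ suc r∈′
  ... | _ , _ , refl = s≤s z≤n , eq
  complete : 1 ≤ r × T (r + 1) ≡ n → r ∈ indices n
  complete (s≤s {n = k} _ , refl) =
    ∈-filter⁺ (λ r → T (r + 1) ≟ n) (∈-map⁺ suc (∈-upTo⁺ (r≤T[r+1] (suc k)))) refl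

indices-unique : ∀ n → Unique (indices n)
indices-unique n = filter⁺ (λ r → T (r + 1) ≟ n) (map⁺ suc-injective (upTo⁺ n))

{-# OPTIONS --safe #-}
module Submission where

-- The Jacobi triple product, written in z = −ζ − ζ⁻¹, is
--   ∏ₙ (1 − qⁿ)(1 + z qⁿ + q²ⁿ) = Σₖ q^(T k) Vₖ(z),   Vₖ(z) = (−1)ᵏ (ζ⁻ᵏ + ⋯ + ζᵏ).
-- Dividing each factor by (1 − qⁿ)(1 + q²ⁿ) turns the left side into ∏ₙ (1 + z xₙ) with
-- xₙ = qⁿ / (1 + q²ⁿ), whose z²-coefficient is A.  Hence D A = Σₖ [z²]Vₖ q^(T k) = S with
-- D = ∏ₙ (1 − qⁿ)(1 + q²ⁿ), and P D = 1 by (1 − qⁿ)(1 + qⁿ) = 1 − q²ⁿ.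
-- The triple product is obtained from its finite form
--   ∏ₙ (1 − qⁿ)(1 + z qⁿ + q²ⁿ) = Σₖ wₖ Vₖ(z)   (1 ≤ n ≤ N, 0 ≤ k ≤ N),
-- wₖ = q^(T k) ∏ⱼ (1 − qʲ) over N − k < j ≤ N and N + k + 1 < j ≤ 2N + 1,
-- which is a recurrence in N because z Vₖ = Vₖ₊₁ + Vₖ₋₁.  Modulo q^(N+1), wₖ is q^(T k).

open import Defs
open import Algebra.Bundles using (CommutativeRing)
import Algebra.Solver.Ring as RingSolver
import Algebra.Solver.Ring.AlmostCommutativeRing as ACR
open import Algebra.Structures using (IsCommutativeRing)
open import Data.Integer.Base as ℤ using (ℤ; +_; 0ℤ; 1ℤ; -1ℤ)
import Data.Integer.Properties as ℤₚ
open import Data.Integer.Solver using (module +-*-Solver)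
open import Data.List.Base using (List; []; _∷_; _++_; map; filter; length; upTo; applyUpTo; cartesianProduct; replicate)
open import Data.List.Membership.Propositional using (_∈_)
open import Data.List.Membership.Propositional.Properties using (∈-filter⁺; ∈-filter⁻; ∈-upTo⁺; ∈-upTo⁻; ∈-map⁺; ∈-map⁻; ∈-++⁺ˡ; ∈-++⁺ʳ; ∈-++⁻; ∈-cartesianProduct⁺; ∈-cartesianProduct⁻)
open import Data.List.Membership.Propositional.Properties.WithK using (unique∧set⇒bag)
open import Data.List.Properties using (map-applyUpTo; map-upTo; filter-accept; filter-reject; ∷-injectiveʳ)
open import Data.List.Relation.Binary.BagAndSetEquality using (∼bag⇒↭)
open import Data.List.Relation.Binary.Disjoint.Propositional using (Disjoint)
open import Data.List.Relation.Binary.Permutation.Propositional as Perm using (_↭_)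
open import Data.List.Relation.Binary.Permutation.Propositional.Properties using () renaming (map⁺ to ↭-map⁺)
open import Data.List.Relation.Unary.All as All using (All; []; _∷_)
import Data.List.Relation.Unary.All.Properties as Allₚ
open import Data.List.Relation.Unary.AllPairs using ([]; _∷_)
open import Data.List.Relation.Unary.Any using (here; there)
open import Data.List.Relation.Unary.Linked as Linked using (Linked; []; [-]; _∷_)
open import Data.List.Relation.Unary.Unique.Propositional using (Unique)
import Data.List.Relation.Unary.Unique.Propositional.Properties as Uniqueₚ
open import Data.Maybe.Base using (Maybe; just; nothing)
open import Data.Nat.Base as ℕ using (ℕ; zero; suc; _<_; _≤_; _≥_; z≤n; s≤s; ⌈_/2⌉)
open import Data.Nat.DivMod using (m*n/n≡m)
open import Data.Nat.Divisibility using (_∣_; divides; ∣⇒≤; ∣m+n∣m⇒∣n)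
open import Data.Nat.ListAction using (sum)
import Data.Nat.Properties as ℕₚ
import Data.Nat.Solver
open import Data.Product.Base using (_×_; _,_; proj₂; ∃₂)
open import Data.Sum.Base using (inj₁; inj₂)
open import Function.Base using (_∘_; id)
open import Function.Bundles using (mk⇔; module Equivalence)
open import Level using (0ℓ)
open import Relation.Binary.PropositionalEquality using (_≡_; _≗_; refl; sym; trans; cong; cong₂; subst; module ≡-Reasoning)
open import Relation.Nullary using (¬_; yes; no; contradiction)

-- The two-sided triple product is Σ (-1)^m q^(T m) ζ^m over all integers m. Its terms m = k and m =
-- -1 - k have the same power of q, and together, divided by 1 - ζ⁻¹, they give Vₖ. Working with the
-- Vₖ as polynomials in z therefore removes Laurent polynomials in ζ altogether. The symmetry k ↔ -1
-- - k survives only as the convention that index -1 means index 0. The weight wₖ is q^(T k) (1 -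
-- q)⋯(1 - q^N) times the Gaussian binomial coefficient of 2N + 1 over N - k. The factor (1 - q)⋯(1
-- - q^N) clears the denominator of that coefficient, so the recurrence in N can be checked without
-- any division; in the limit it also cancels what remains of the coefficient. No infinite sum or
-- product is formed: a coefficient of index n is compared modulo q^M for some M > n, where inverses
-- are finite geometric sums.

private module N = Data.Nat.Solver.+-*-Solver

-- The ring of formal power series

infixl 6 _⊕_
infix  8 ⊖_

_⊕_ : PowerSeries → PowerSeries → PowerSeries
(f ⊕ g) n = f n ℤ.+ g n

⊖_ : PowerSeries → PowerSeries
(⊖ f) n = ℤ.- f n

𝟘 : PowerSeries
𝟘 _ = 0ℤ

monomial : ℤ → ℕ → PowerSeries
monomial c zero    zero    = c
monomial c zero    (suc n) = 0ℤ
monomial c (suc e) zero    = 0ℤ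
monomial c (suc e) (suc n) = monomial c e n

𝟙 : PowerSeries
𝟙 = monomial 1ℤ 0

tail : PowerSeries → PowerSeries
tail f n = f (suc n)

⊛-zero : ∀ f g → (f ⊛ g) 0 ≡ f 0 ℤ.* g 0
⊛-zero f g = ℤₚ.+-identityʳ _

-- Splitting off the term i = 0 makes the convolution recursive in the degree; the ring laws below
-- are inductions through this step.
⊛-suc : ∀ f g n → (f ⊛ g) (suc n) ≡ f 0 ℤ.* g (suc n) ℤ.+ (tail f ⊛ g) n
⊛-suc f g n = cong (λ xs → f 0 ℤ.* g (suc n) ℤ.+ sumℤ xs)
  (trans (map-applyUpTo suc (λ i → f i ℤ.* g (suc n ℕ.∸ i)) (suc n))
    (sym (map-upTo (λ i → f (suc i) ℤ.* g (n ℕ.∸ i)) (suc n))))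

-- This locality makes multiplication well defined modulo q^M, and at the end lets truncated factors
-- be replaced by `P` and `S`.
⊛-cong-≤ : ∀ {f f′ g g′} n → (∀ i → i ≤ n → f i ≡ f′ i) → (∀ i → i ≤ n → g i ≡ g′ i) →
           (f ⊛ g) n ≡ (f′ ⊛ g′) n
⊛-cong-≤ {f} {f′} {g} {g′} zero p r = begin
  (f ⊛ g) 0      ≡⟨ ⊛-zero f g ⟩
  f 0 ℤ.* g 0    ≡⟨ cong₂ ℤ._*_ (p 0 z≤n) (r 0 z≤n) ⟩
  f′ 0 ℤ.* g′ 0  ≡⟨ ⊛-zero f′ g′ ⟨
  (f′ ⊛ g′) 0    ∎
  where open ≡-Reasoning
⊛-cong-≤ {f} {f′} {g} {g′} (suc n) p r = begin
  (f ⊛ g) (suc n)                            ≡⟨ ⊛-suc f g n ⟩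
  f 0 ℤ.* g (suc n) ℤ.+ (tail f ⊛ g) n       ≡⟨ cong₂ ℤ._+_
    (cong₂ ℤ._*_ (p 0 z≤n) (r (suc n) ℕₚ.≤-refl))
    (⊛-cong-≤ n (λ i i≤n → p (suc i) (s≤s i≤n)) (λ i i≤n → r i (ℕₚ.m≤n⇒m≤1+n i≤n))) ⟩
  f′ 0 ℤ.* g′ (suc n) ℤ.+ (tail f′ ⊛ g′) n   ≡⟨ ⊛-suc f′ g′ n ⟨
  (f′ ⊛ g′) (suc n)                          ∎
  where open ≡-Reasoning

-- Once the first term is split off, the remainder `tail f ⊛ g` is swapped by induction and split
-- again. What is left, `tail g ⊛ tail f`, is two degrees lower, hence the two base cases.
⊛-comm : ∀ f g → f ⊛ g ≗ g ⊛ f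
⊛-comm f g zero = trans (⊛-zero f g) (trans (ℤₚ.*-comm (f 0) (g 0)) (sym (⊛-zero g f)))
⊛-comm f g (suc zero) = begin
  (f ⊛ g) 1                                ≡⟨ expand f g ⟩
  f 0 ℤ.* g 1 ℤ.+ f 1 ℤ.* g 0              ≡⟨ solve 4 (λ a b c d → a :* b :+ c :* d := d :* c :+ b :* a) refl (f 0) (g 1) (f 1) (g 0) ⟩
  g 0 ℤ.* f 1 ℤ.+ g 1 ℤ.* f 0              ≡⟨ expand g f ⟨
  (g ⊛ f) 1                                ∎
  where
  open ≡-Reasoning
  open +-*-Solver
  expand : ∀ f g → (f ⊛ g) 1 ≡ f 0 ℤ.* g 1 ℤ.+ f 1 ℤ.* g 0
  expand f g = trans (⊛-suc f g 0) (cong (λ t → f 0 ℤ.* g 1 ℤ.+ t) (⊛-zero (tail f) g))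
⊛-comm f g (suc (suc n)) = begin
  (f ⊛ g) (suc (suc n))                    ≡⟨ expand f g (⊛-comm (tail f) g (suc n)) ⟩
  x ℤ.+ (y ℤ.+ (tail g ⊛ tail f) n)        ≡⟨ cong (λ t → x ℤ.+ (y ℤ.+ t)) (⊛-comm (tail g) (tail f) n) ⟩
  x ℤ.+ (y ℤ.+ (tail f ⊛ tail g) n)        ≡⟨ solve 3 (λ x y t → x :+ (y :+ t) := y :+ (x :+ t)) refl x y _ ⟩
  y ℤ.+ (x ℤ.+ (tail f ⊛ tail g) n)        ≡⟨ expand g f (⊛-comm (tail g) f (suc n)) ⟨
  (g ⊛ f) (suc (suc n))                    ∎
  where
  open ≡-Reasoning
  open +-*-Solver
  x = f 0 ℤ.* g (suc (suc n))
  y = g 0 ℤ.* f (suc (suc n))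
  expand : ∀ f g → (tail f ⊛ g) (suc n) ≡ (g ⊛ tail f) (suc n) →
           (f ⊛ g) (suc (suc n)) ≡
           f 0 ℤ.* g (suc (suc n)) ℤ.+ (g 0 ℤ.* f (suc (suc n)) ℤ.+ (tail g ⊛ tail f) n)
  expand f g comm = trans (⊛-suc f g (suc n))
    (cong (λ t → f 0 ℤ.* g (suc (suc n)) ℤ.+ t) (trans comm (⊛-suc g (tail f) n)))

⊛-distribʳ : ∀ f g h → (g ⊕ h) ⊛ f ≗ (g ⊛ f) ⊕ (h ⊛ f)
⊛-distribʳ f g h zero = begin
  ((g ⊕ h) ⊛ f) 0               ≡⟨ ⊛-zero (g ⊕ h) f ⟩
  (g 0 ℤ.+ h 0) ℤ.* f 0         ≡⟨ ℤₚ.*-distribʳ-+ (f 0) (g 0) (h 0) ⟩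
  g 0 ℤ.* f 0 ℤ.+ h 0 ℤ.* f 0   ≡⟨ cong₂ ℤ._+_ (⊛-zero g f) (⊛-zero h f) ⟨
  (g ⊛ f) 0 ℤ.+ (h ⊛ f) 0       ∎
  where open ≡-Reasoning
⊛-distribʳ f g h (suc n) = begin
  ((g ⊕ h) ⊛ f) (suc n)
    ≡⟨ ⊛-suc (g ⊕ h) f n ⟩
  (g 0 ℤ.+ h 0) ℤ.* f (suc n) ℤ.+ ((tail g ⊕ tail h) ⊛ f) n
    ≡⟨ cong (λ t → (g 0 ℤ.+ h 0) ℤ.* f (suc n) ℤ.+ t) (⊛-distribʳ f (tail g) (tail h) n) ⟩
  (g 0 ℤ.+ h 0) ℤ.* f (suc n) ℤ.+ ((tail g ⊛ f) n ℤ.+ (tail h ⊛ f) n)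
    ≡⟨ solve 5 (λ a b c s t → (a :+ b) :* c :+ (s :+ t) := (a :* c :+ s) :+ (b :* c :+ t))
         refl (g 0) (h 0) (f (suc n)) _ _ ⟩
  (g 0 ℤ.* f (suc n) ℤ.+ (tail g ⊛ f) n) ℤ.+ (h 0 ℤ.* f (suc n) ℤ.+ (tail h ⊛ f) n)
    ≡⟨ cong₂ ℤ._+_ (⊛-suc g f n) (⊛-suc h f n) ⟨
  (g ⊛ f) (suc n) ℤ.+ (h ⊛ f) (suc n) ∎
  where
  open ≡-Reasoning
  open +-*-Solver

scale : ℤ → PowerSeries → PowerSeries
scale c f n = c ℤ.* f n

scale-⊛ : ∀ c f g → scale c f ⊛ g ≗ scale c (f ⊛ g)
scale-⊛ c f g zero = trans (⊛-zero (scale c f) g)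
  (trans (ℤₚ.*-assoc c (f 0) (g 0)) (cong (c ℤ.*_) (sym (⊛-zero f g))))
scale-⊛ c f g (suc n) = begin
  (scale c f ⊛ g) (suc n)                            ≡⟨ ⊛-suc (scale c f) g n ⟩
  c ℤ.* f 0 ℤ.* g (suc n) ℤ.+ (scale c (tail f) ⊛ g) n  ≡⟨ cong (λ t → c ℤ.* f 0 ℤ.* g (suc n) ℤ.+ t) (scale-⊛ c (tail f) g n) ⟩
  c ℤ.* f 0 ℤ.* g (suc n) ℤ.+ c ℤ.* (tail f ⊛ g) n   ≡⟨ solve 4 (λ c a b t → c :* a :* b :+ c :* t := c :* (a :* b :+ t)) refl c (f 0) (g (suc n)) _ ⟩
  c ℤ.* (f 0 ℤ.* g (suc n) ℤ.+ (tail f ⊛ g) n)       ≡⟨ cong (c ℤ.*_) (⊛-suc f g n) ⟨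
  c ℤ.* (f ⊛ g) (suc n)                              ∎
  where
  open ≡-Reasoning
  open +-*-Solver

-- The tail of a product is `scale (f 0) (tail g) ⊕ (tail f ⊛ g)`, so the induction needs
-- distributivity and the compatibility with scalars.
⊛-assoc : ∀ f g h → (f ⊛ g) ⊛ h ≗ f ⊛ (g ⊛ h)
⊛-assoc f g h zero = begin
  ((f ⊛ g) ⊛ h) 0            ≡⟨ ⊛-zero (f ⊛ g) h ⟩
  (f ⊛ g) 0 ℤ.* h 0          ≡⟨ cong (ℤ._* h 0) (⊛-zero f g) ⟩
  f 0 ℤ.* g 0 ℤ.* h 0        ≡⟨ ℤₚ.*-assoc (f 0) (g 0) (h 0) ⟩
  f 0 ℤ.* (g 0 ℤ.* h 0)      ≡⟨ cong (f 0 ℤ.*_) (⊛-zero g h) ⟨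
  f 0 ℤ.* (g ⊛ h) 0          ≡⟨ ⊛-zero f (g ⊛ h) ⟨
  (f ⊛ (g ⊛ h)) 0            ∎
  where open ≡-Reasoning
⊛-assoc f g h (suc n) = begin
  ((f ⊛ g) ⊛ h) (suc n)
    ≡⟨ ⊛-suc (f ⊛ g) h n ⟩
  (f ⊛ g) 0 ℤ.* h (suc n) ℤ.+ (tail (f ⊛ g) ⊛ h) n
    ≡⟨ cong₂ ℤ._+_ (cong (ℤ._* h (suc n)) (⊛-zero f g))
         (⊛-cong-≤ {g = h} {g′ = h} n (λ i _ → ⊛-suc f g i) (λ _ _ → refl)) ⟩
  f 0 ℤ.* g 0 ℤ.* h (suc n) ℤ.+ ((scale (f 0) (tail g) ⊕ (tail f ⊛ g)) ⊛ h) n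
    ≡⟨ cong (λ t → f 0 ℤ.* g 0 ℤ.* h (suc n) ℤ.+ t)
         (trans (⊛-distribʳ h (scale (f 0) (tail g)) (tail f ⊛ g) n)
           (cong₂ ℤ._+_ (scale-⊛ (f 0) (tail g) h n) (⊛-assoc (tail f) g h n))) ⟩
  f 0 ℤ.* g 0 ℤ.* h (suc n) ℤ.+ (f 0 ℤ.* (tail g ⊛ h) n ℤ.+ (tail f ⊛ (g ⊛ h)) n)
    ≡⟨ solve 5 (λ a b c s t → a :* b :* c :+ (a :* s :+ t) := a :* (b :* c :+ s) :+ t)
         refl (f 0) (g 0) (h (suc n)) _ _ ⟩
  f 0 ℤ.* (g 0 ℤ.* h (suc n) ℤ.+ (tail g ⊛ h) n) ℤ.+ (tail f ⊛ (g ⊛ h)) n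
    ≡⟨ cong (λ t → f 0 ℤ.* t ℤ.+ (tail f ⊛ (g ⊛ h)) n) (⊛-suc g h n) ⟨
  f 0 ℤ.* (g ⊛ h) (suc n) ℤ.+ (tail f ⊛ (g ⊛ h)) n
    ≡⟨ ⊛-suc f (g ⊛ h) n ⟨
  (f ⊛ (g ⊛ h)) (suc n) ∎
  where
  open ≡-Reasoning
  open +-*-Solver

𝟘-⊛ : ∀ f → 𝟘 ⊛ f ≗ 𝟘
𝟘-⊛ f zero    = trans (⊛-zero 𝟘 f) (ℤₚ.*-zeroˡ (f 0))
𝟘-⊛ f (suc n) = trans (⊛-suc 𝟘 f n) (cong₂ ℤ._+_ (ℤₚ.*-zeroˡ (f (suc n))) (𝟘-⊛ f n))

constant-⊛ : ∀ c f → monomial c 0 ⊛ f ≗ scale c f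
constant-⊛ c f zero    = ⊛-zero (monomial c 0) f
constant-⊛ c f (suc n) = trans (⊛-suc (monomial c 0) f n)
  (trans (cong (λ t → c ℤ.* f (suc n) ℤ.+ t) (𝟘-⊛ f n)) (ℤₚ.+-identityʳ _))

monomial-0 : ∀ e n → monomial 0ℤ e n ≡ 0ℤ
monomial-0 zero    zero    = refl
monomial-0 zero    (suc n) = refl
monomial-0 (suc e) zero    = refl
monomial-0 (suc e) (suc n) = monomial-0 e n

monomial-⊛ : ∀ c d e k → monomial c e ⊛ monomial d k ≗ monomial (c ℤ.* d) (e ℕ.+ k)
monomial-⊛ c d zero k n = trans (constant-⊛ c (monomial d k) n) (scale-monomial k n)
  where
  scale-monomial : ∀ k n → c ℤ.* monomial d k n ≡ monomial (c ℤ.* d) k n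
  scale-monomial zero    zero    = refl
  scale-monomial zero    (suc n) = ℤₚ.*-zeroʳ c
  scale-monomial (suc k) zero    = ℤₚ.*-zeroʳ c
  scale-monomial (suc k) (suc n) = scale-monomial k n
monomial-⊛ c d (suc e) k zero    = trans (⊛-zero (monomial c (suc e)) (monomial d k)) (ℤₚ.*-zeroˡ (monomial d k 0))
monomial-⊛ c d (suc e) k (suc n) = trans (⊛-suc (monomial c (suc e)) (monomial d k) n)
  (trans (cong₂ ℤ._+_ (ℤₚ.*-zeroˡ (monomial d k (suc n))) (monomial-⊛ c d e k n)) (ℤₚ.+-identityˡ _))

monomial-⊕ : ∀ c d e → monomial (c ℤ.+ d) e ≗ monomial c e ⊕ monomial d e
monomial-⊕ c d zero    zero    = refl
monomial-⊕ c d zero    (suc n) = refl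
monomial-⊕ c d (suc e) zero    = refl
monomial-⊕ c d (suc e) (suc n) = monomial-⊕ c d e n

monomial-⊖ : ∀ c e → monomial (ℤ.- c) e ≗ ⊖ monomial c e
monomial-⊖ c zero    zero    = refl
monomial-⊖ c zero    (suc n) = refl
monomial-⊖ c (suc e) zero    = refl
monomial-⊖ c (suc e) (suc n) = monomial-⊖ c e n

monomial-at : ∀ c e → monomial c e e ≡ c
monomial-at c zero    = refl
monomial-at c (suc e) = monomial-at c e

monomial-off : ∀ c {e n} → ¬ e ≡ n → monomial c e n ≡ 0ℤ
monomial-off c {zero}  {zero}  e≢n = contradiction refl e≢n
monomial-off c {zero}  {suc n} e≢n = refl
monomial-off c {suc e} {zero}  e≢n = refl
monomial-off c {suc e} {suc n} e≢n = monomial-off c (e≢n ∘ cong suc)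

-- Triangular numbers and the low coefficients of Vₖ

tri : ℕ → ℕ
tri zero    = 0
tri (suc n) = tri n ℕ.+ suc n

n≤tri : ∀ n → n ≤ tri n
n≤tri zero    = z≤n
n≤tri (suc n) = ℕₚ.m≤n+m (suc n) (tri n)

n*[n+1]≡tri*2 : ∀ n → n ℕ.* (n ℕ.+ 1) ≡ tri n ℕ.* 2
n*[n+1]≡tri*2 zero    = refl
n*[n+1]≡tri*2 (suc n) = begin
  suc n ℕ.* (suc n ℕ.+ 1)
    ≡⟨ N.solve 1 (λ n → (N.con 1 N.:+ n) N.:* ((N.con 1 N.:+ n) N.:+ N.con 1)
         N.:= n N.:* (n N.:+ N.con 1) N.:+ (N.con 1 N.:+ n) N.:* N.con 2) refl n ⟩
  n ℕ.* (n ℕ.+ 1) ℕ.+ suc n ℕ.* 2  ≡⟨ cong (λ m → m ℕ.+ suc n ℕ.* 2) (n*[n+1]≡tri*2 n) ⟩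
  tri n ℕ.* 2 ℕ.+ suc n ℕ.* 2      ≡⟨ ℕₚ.*-distribʳ-+ 2 (tri n) (suc n) ⟨
  (tri n ℕ.+ suc n) ℕ.* 2          ∎
  where open ≡-Reasoning

T≡tri : ∀ n → T n ≡ tri n
T≡tri n = trans (cong (λ m → m ℕ./ 2) (n*[n+1]≡tri*2 n)) (m*n/n≡m (tri n) 2)

-- Coefficients of the polynomials V₀ = 1, V₁ = z − 1, Vₖ₊₂ = z Vₖ₊₁ − Vₖ, that is
-- Vₖ(−ζ − ζ⁻¹) = (−1)ᵏ (ζ⁻ᵏ + ⋯ + ζᵏ).
V-coeff : ℕ → ℕ → ℤ
V-coeff zero          zero          = 1ℤ
V-coeff zero          (suc j)       = 0ℤ
V-coeff (suc zero)    zero          = -1ℤ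
V-coeff (suc zero)    (suc zero)    = 1ℤ
V-coeff (suc zero)    (suc (suc j)) = 0ℤ
V-coeff (suc (suc k)) zero          = ℤ.- V-coeff k zero
V-coeff (suc (suc k)) (suc j)       = V-coeff (suc k) j ℤ.- V-coeff k (suc j)

triSign : ℕ → ℤ
triSign n = -1ℤ ℤ.^ tri n

-1^[2+n] : ∀ n → -1ℤ ℤ.^ suc (suc n) ≡ -1ℤ ℤ.^ n
-1^[2+n] n = trans (sym (ℤₚ.*-assoc -1ℤ -1ℤ _)) (ℤₚ.*-identityˡ _)

-1^[1+2m+n] : ∀ m n → -1ℤ ℤ.^ suc (m ℕ.+ m ℕ.+ n) ≡ ℤ.- (-1ℤ ℤ.^ n)
-1^[1+2m+n] zero    n = ℤₚ.-1*i≡-i _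
-1^[1+2m+n] (suc m) n = begin
  -1ℤ ℤ.^ suc (suc (m ℕ.+ suc m ℕ.+ n))    ≡⟨ cong (λ e → -1ℤ ℤ.^ suc (suc (e ℕ.+ n))) (ℕₚ.+-suc m m) ⟩
  -1ℤ ℤ.^ suc (suc (suc (m ℕ.+ m ℕ.+ n)))  ≡⟨ -1^[2+n] (suc (m ℕ.+ m ℕ.+ n)) ⟩
  -1ℤ ℤ.^ suc (m ℕ.+ m ℕ.+ n)              ≡⟨ -1^[1+2m+n] m n ⟩
  ℤ.- (-1ℤ ℤ.^ n)                          ∎
  where open ≡-Reasoning

-- The two triangular numbers differ by 2n + 3, which is odd.
triSign-2+ : ∀ n → triSign (suc (suc n)) ≡ ℤ.- triSign n
triSign-2+ n = trans
  (cong (λ e → -1ℤ ℤ.^ e) (N.solve 2 (λ t n → (t N.:+ (N.con 1 N.:+ n)) N.:+ (N.con 2 N.:+ n)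
    N.:= N.con 1 N.:+ ((N.con 1 N.:+ n) N.:+ (N.con 1 N.:+ n) N.:+ t)) refl (tri n) n))
  (-1^[1+2m+n] (suc n) (tri n))

V-coeff₀ : ∀ k → V-coeff k 0 ≡ triSign k
V-coeff₀ zero          = refl
V-coeff₀ (suc zero)    = refl
V-coeff₀ (suc (suc k)) = trans (cong ℤ.-_ (V-coeff₀ k)) (sym (triSign-2+ k))

V-coeff₁ : ∀ k → V-coeff (suc k) 1 ≡ triSign k ℤ.* + ⌈ suc k /2⌉
V-coeff₁ zero          = refl
V-coeff₁ (suc zero)    = refl
V-coeff₁ (suc (suc k)) = begin
  V-coeff (suc (suc k)) 0 ℤ.- V-coeff (suc k) 1
    ≡⟨ cong₂ ℤ._-_ (V-coeff₀ (suc (suc k))) (V-coeff₁ k) ⟩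
  triSign (suc (suc k)) ℤ.- triSign k ℤ.* + m
    ≡⟨ cong (λ s → s ℤ.- triSign k ℤ.* + m) (triSign-2+ k) ⟩
  ℤ.- triSign k ℤ.- triSign k ℤ.* + m
    ≡⟨ solve 2 (λ s m → :- s :- s :* m := :- s :* (con 1ℤ :+ m)) refl (triSign k) (+ m) ⟩
  ℤ.- triSign k ℤ.* + suc m
    ≡⟨ cong (λ s → s ℤ.* + suc m) (triSign-2+ k) ⟨
  triSign (suc (suc k)) ℤ.* + suc m ∎
  where
  open ≡-Reasoning
  open +-*-Solver
  m = ⌈ suc k /2⌉

-- With r = k + 1 this is the coefficient in `S`. Over two steps of k the sign flips, `⌈ suc k /2⌉`
-- grows by one to `suc m`, and the linear coefficient contributes exactly the increment `suc m`
-- from `tri m` to `tri (suc m)`.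
V-coeff₂ : ∀ k → V-coeff (suc (suc k)) 2 ≡ triSign k ℤ.* + tri ⌈ suc k /2⌉
V-coeff₂ zero          = refl
V-coeff₂ (suc zero)    = refl
V-coeff₂ (suc (suc k)) = begin
  V-coeff (suc (suc (suc k))) 1 ℤ.- V-coeff (suc (suc k)) 2
    ≡⟨ cong₂ ℤ._-_ (V-coeff₁ (suc (suc k))) (V-coeff₂ k) ⟩
  triSign (suc (suc k)) ℤ.* + suc m ℤ.- triSign k ℤ.* + tri m
    ≡⟨ cong (λ s → s ℤ.* + suc m ℤ.- triSign k ℤ.* + tri m) (triSign-2+ k) ⟩
  ℤ.- triSign k ℤ.* + suc m ℤ.- triSign k ℤ.* + tri m
    ≡⟨ solve 3 (λ s m t → :- s :* m :- s :* t := :- s :* (t :+ m)) refl (triSign k) (+ suc m) (+ tri m) ⟩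
  ℤ.- triSign k ℤ.* (+ tri m ℤ.+ + suc m)
    ≡⟨ cong₂ ℤ._*_ (triSign-2+ k) (ℤₚ.pos-+ (tri m) (suc m)) ⟨
  triSign (suc (suc k)) ℤ.* + tri (suc m) ∎
  where
  open ≡-Reasoning
  open +-*-Solver
  m = ⌈ suc k /2⌉

-- Enumerations of the summands

size : Quadruple → ℕ
size (x , y , r₁ , r₂) = (2 ℕ.* r₁ ℕ.+ 1) ℕ.* x ℕ.+ (2 ℕ.* r₂ ℕ.+ 1) ℕ.* y

place : ℕ → ℕ × ℕ × ℕ → Quadruple
place N (x , r₁ , r₂) = suc x , suc N , r₁ , r₂

-- Layered by the larger part y, so that the layers follow the recursion of the second elementary
-- symmetric polynomial. Multiplicity indices below M are enough modulo q^M.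
quadruples : ℕ → ℕ → List Quadruple
quadruples M zero    = []
quadruples M (suc N) = quadruples M N ++
  map (place N) (cartesianProduct (upTo N) (cartesianProduct (upTo M) (upTo M)))

-- A strict upper bound on the number of parts p in a partition of some n < M.
maxCopies : ℕ → ℕ → ℕ
maxCopies M p with odd? p
... | yes _ = 2
... | no  _ = M

prepend : ℕ → ℕ × List ℕ → List ℕ
prepend p (m , ps) = replicate m p ++ ps

-- Layered by the number of copies of the largest admissible part: each layer contributes one factor
-- to the generating product.
partitionsUpTo : ℕ → ℕ → List (List ℕ)
partitionsUpTo M zero    = [] ∷ []
partitionsUpTo M (suc k) =
  map (prepend (suc k)) (cartesianProduct (upTo (maxCopies M (suc k))) (partitionsUpTo M k))

S-coefficient : ℕ → ℤ
S-coefficient r = -1ℤ ℤ.^ T (r ℕ.∸ 1) ℤ.* + T ⌈ r /2⌉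

sum-prepend : ∀ p m ps → sum (prepend p (m , ps)) ≡ m ℕ.* p ℕ.+ sum ps
sum-prepend p zero    ps = refl
sum-prepend p (suc m) ps = trans (cong (p ℕ.+_) (sum-prepend p m ps)) (sym (ℕₚ.+-assoc p (m ℕ.* p) (sum ps)))

2∣n+n : ∀ n → 2 ∣ n ℕ.+ n
2∣n+n n = divides n (N.solve 1 (λ n → n N.:+ n N.:= n N.:* N.con 2) refl n)

odd-1+n+n : ∀ n → Odd (suc (n ℕ.+ n))
odd-1+n+n n 2∣1+n+n with ∣⇒≤ (∣m+n∣m⇒∣n (subst (2 ∣_) (ℕₚ.+-comm 1 (n ℕ.+ n)) 2∣1+n+n) (2∣n+n n))
... | s≤s ()

-- A ring with monomials c qᵉ that vanish from degree M on; the model is ℤ[[q]] / (q^M), in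
-- which all sums and products below are finite.  Keeping it abstract also prevents the
-- convolutions from being unfolded.
record MonomialRing (M : ℕ) : Set₁ where
  field
    commutativeRing : CommutativeRing 0ℓ 0ℓ
  open CommutativeRing commutativeRing public hiding (zero)
  field
    cq^          : ℤ → ℕ → Carrier
    cq^-0        : ∀ e → cq^ 0ℤ e ≈ 0#
    cq^-1        : cq^ 1ℤ 0 ≈ 1#
    cq^-+        : ∀ c d e → cq^ (c ℤ.+ d) e ≈ cq^ c e + cq^ d e
    cq^-neg      : ∀ c e → cq^ (ℤ.- c) e ≈ - cq^ c e
    cq^-*        : ∀ c d e k → cq^ (c ℤ.* d) (e ℕ.+ k) ≈ cq^ c e * cq^ d k
    cq^-vanishes : ∀ c {e} → M ≤ e → cq^ c e ≈ 0#

-- Power series modulo q^M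

module Truncated (M : ℕ) where

  infix 4 _≈_

  record _≈_ (f g : PowerSeries) : Set where
    constructor below
    field coefficients : ∀ n → n < M → f n ≡ g n

  open _≈_ public

  ≗⇒≈ : ∀ {f g} → f ≗ g → f ≈ g
  ≗⇒≈ eq = below λ n _ → eq n

  isCommutativeRing : IsCommutativeRing _≈_ _⊕_ _⊛_ ⊖_ 𝟘 𝟙
  isCommutativeRing = record
    { isRing = record
      { +-isAbelianGroup = record
        { isGroup = record
          { isMonoid = record
            { isSemigroup = record
              { isMagma = record
                { isEquivalence = record
                  { refl  = below λ _ _ → refl
                  ; sym   = λ p → below λ n n<M → sym (coefficients p n n<M)
                  ; trans = λ p r → below λ n n<M → trans (coefficients p n n<M) (coefficients r n n<M)
                  }
                ; ∙-cong = λ p r → below λ n n<M → cong₂ ℤ._+_ (coefficients p n n<M) (coefficients r n n<M)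
                }
              ; assoc = λ f g h → ≗⇒≈ λ n → ℤₚ.+-assoc (f n) (g n) (h n)
              }
            ; identity = (λ f → ≗⇒≈ λ n → ℤₚ.+-identityˡ (f n)) , (λ f → ≗⇒≈ λ n → ℤₚ.+-identityʳ (f n))
            }
          ; inverse = (λ f → ≗⇒≈ λ n → ℤₚ.+-inverseˡ (f n)) , (λ f → ≗⇒≈ λ n → ℤₚ.+-inverseʳ (f n))
          ; ⁻¹-cong = λ p → below λ n n<M → cong ℤ.-_ (coefficients p n n<M)
          }
        ; comm = λ f g → ≗⇒≈ λ n → ℤₚ.+-comm (f n) (g n)
        }
      ; *-cong = λ p r → below λ n n<M → ⊛-cong-≤ n
          (λ i i≤n → coefficients p i (ℕₚ.≤-<-trans i≤n n<M))
          (λ i i≤n → coefficients r i (ℕₚ.≤-<-trans i≤n n<M))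
      ; *-assoc = λ f g h → ≗⇒≈ (⊛-assoc f g h)
      ; *-identity =
          (λ f → ≗⇒≈ (identityˡ f)) ,
          (λ f → ≗⇒≈ λ n → trans (⊛-comm f 𝟙 n) (identityˡ f n))
      ; distrib =
          (λ f g h → ≗⇒≈ λ n → trans (⊛-comm f (g ⊕ h) n)
            (trans (⊛-distribʳ f g h n) (cong₂ ℤ._+_ (⊛-comm g f n) (⊛-comm h f n)))) ,
          (λ f g h → ≗⇒≈ (⊛-distribʳ f g h))
      }
    ; *-comm = λ f g → ≗⇒≈ (⊛-comm f g)
    }
    where
    identityˡ : ∀ f → 𝟙 ⊛ f ≗ f
    identityˡ f n = trans (constant-⊛ 1ℤ f n) (ℤₚ.*-identityˡ (f n))

  monomialRing : MonomialRing M
  monomialRing = record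
    { commutativeRing = record { isCommutativeRing = isCommutativeRing }
    ; cq^ = monomial
    ; cq^-0 = λ e → ≗⇒≈ (monomial-0 e)
    ; cq^-1 = ≗⇒≈ λ _ → refl
    ; cq^-+ = λ c d e → ≗⇒≈ (monomial-⊕ c d e)
    ; cq^-neg = λ c e → ≗⇒≈ (monomial-⊖ c e)
    ; cq^-* = λ c d e k → ≗⇒≈ λ n → sym (monomial-⊛ c d e k n)
    ; cq^-vanishes = λ c {e} M≤e → below λ n n<M →
        monomial-off c {e} {n} λ { refl → ℕₚ.<⇒≱ n<M M≤e }
    }

module Identities {M : ℕ} (𝓡 : MonomialRing M) where

  open MonomialRing 𝓡 renaming (refl to ≈-refl; sym to ≈-sym; trans to ≈-trans; reflexive to ≈-reflexive)
  open import Relation.Binary.Reasoning.Setoid setoid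

  private
    acr = ACR.fromCommutativeRing commutativeRing

    -- Sends 0 and 1 definitionally to 0# and 1#, as the solver's constants must be.
    ι : ℤ → Carrier
    ι (+ 0) = 0#
    ι (+ 1) = 1#
    ι c     = cq^ c 0

    ι≈ : ∀ c → ι c ≈ cq^ c 0
    ι≈ (+ 0)             = ≈-sym (cq^-0 0)
    ι≈ (+ 1)             = ≈-sym cq^-1
    ι≈ (+ suc (suc _))   = ≈-refl
    ι≈ ℤ.-[1+ _ ]        = ≈-refl

    constants : CommutativeRing.rawRing ℤₚ.+-*-commutativeRing ACR.-Raw-AlmostCommutative⟶ acr
    constants = record
      { ⟦_⟧    = ι
      ; +-homo = λ c d → ≈-trans (ι≈ (c ℤ.+ d)) (≈-trans (cq^-+ c d 0) (+-cong (≈-sym (ι≈ c)) (≈-sym (ι≈ d))))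
      ; *-homo = λ c d → ≈-trans (ι≈ (c ℤ.* d)) (≈-trans (cq^-* c d 0 0) (*-cong (≈-sym (ι≈ c)) (≈-sym (ι≈ d))))
      ; -‿homo = λ c → ≈-trans (ι≈ (ℤ.- c)) (≈-trans (cq^-neg c 0) (-‿cong (≈-sym (ι≈ c))))
      ; 0-homo = ≈-refl
      ; 1-homo = ≈-refl
      }

    _≟ᶜ_ : ∀ c d → Maybe (ι c ≈ ι d)
    c ≟ᶜ d with c ℤₚ.≟ d
    ... | yes refl = just ≈-refl
    ... | no _     = nothing

  module S = RingSolver (CommutativeRing.rawRing ℤₚ.+-*-commutativeRing) acr constants _≟ᶜ_

  q^ : ℕ → Carrier
  q^ e = cq^ 1ℤ e

  1-q^ : ℕ → Carrier
  1-q^ e = 1# - q^ e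

  q^-+ : ∀ d e → q^ (d ℕ.+ e) ≈ q^ d * q^ e
  q^-+ d e = cq^-* 1ℤ 1ℤ d e

  q^-≡ : ∀ {d e} → d ≡ e → q^ d ≈ q^ e
  q^-≡ eq = ≈-reflexive (cong q^ eq)

  -- A finite form of the Jacobi triple product

  -- pochhammer m b = (1 − q^(b+1)) ⋯ (1 − q^(b+m))
  pochhammer : ℕ → ℕ → Carrier
  pochhammer zero    b = 1#
  pochhammer (suc m) b = pochhammer m b * 1-q^ (suc (b ℕ.+ m))

  pochhammer-≡ : ∀ m {b c} → b ≡ c → pochhammer m b ≈ pochhammer m c
  pochhammer-≡ m eq = ≈-reflexive (cong (pochhammer m) eq)

  1-q^-≡ : ∀ {d e} → d ≡ e → 1-q^ d ≈ 1-q^ e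
  1-q^-≡ eq = ≈-reflexive (cong 1-q^ eq)

  pochhammer-front : ∀ m b → pochhammer (suc m) b ≈ 1-q^ (suc b) * pochhammer m (suc b)
  pochhammer-front zero b = begin
    1# * 1-q^ (suc (b ℕ.+ 0))   ≈⟨ *-comm _ _ ⟩
    1-q^ (suc (b ℕ.+ 0)) * 1#   ≈⟨ *-cong (1-q^-≡ (cong suc (ℕₚ.+-identityʳ b))) ≈-refl ⟩
    1-q^ (suc b) * 1#           ∎
  pochhammer-front (suc m) b = begin
    pochhammer (suc m) b * 1-q^ (suc (b ℕ.+ suc m))
      ≈⟨ *-cong (pochhammer-front m b) (1-q^-≡ (cong suc (ℕₚ.+-suc b m))) ⟩
    (1-q^ (suc b) * pochhammer m (suc b)) * 1-q^ (suc (suc b ℕ.+ m))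
      ≈⟨ *-assoc _ _ _ ⟩
    1-q^ (suc b) * pochhammer (suc m) (suc b) ∎

  -- What is left of weight N (k + 1), b = N − k and c = 2k, in the recurrence for
  -- weight (N + 1) k once the factor common to all terms is removed.
  nextFactor : ℕ → ℕ → Carrier
  nextFactor zero    c = 0#
  nextFactor (suc b) c = 1-q^ (suc b) * (1-q^ (suc (suc b)) * pochhammer b (suc (suc (suc b ℕ.+ c))))

  -- This is the recurrence for the weights at b = N - k, c = 2k, after cancelling their common
  -- factor: the three summands come from the weights at k, k - 1 and k + 1. For b > 0 every term is
  -- a multiple of one Pochhammer product `J`, and what remains is a polynomial identity in q, q^b
  -- and q^c. For b = 0 the weight at k + 1 is zero and `J` would have negative length.
  pochhammer-contiguous : ∀ b c →
    (1# + q^ (suc (suc (b ℕ.+ (b ℕ.+ c))))) * (1-q^ (suc b) * pochhammer b (suc (b ℕ.+ c)))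
      + (q^ (suc b) * pochhammer (suc b) (b ℕ.+ c) + q^ (suc (suc (b ℕ.+ c))) * nextFactor b c)
    ≈ pochhammer (suc b) (suc (suc (b ℕ.+ c)))
  pochhammer-contiguous zero c = begin
    (1# + q^ (suc (suc c))) * (1-q^ 1 * 1#)
      + (q^ 1 * (1# * 1-q^ (suc (c ℕ.+ 0))) + q^ (suc (suc c)) * 0#)
      ≈⟨ +-cong (*-cong (+-cong ≈-refl e₂) ≈-refl)
           (+-cong (*-cong ≈-refl (*-cong ≈-refl (+-cong ≈-refl (-‿cong e₁)))) (zeroʳ _)) ⟩
    (1# + q * (q * z)) * ((1# - q) * 1#) + (q * (1# * (1# - (q * z))) + 0#)
      ≈⟨ +-cong ≈-refl (+-identityʳ _) ⟩
    (1# + q * (q * z)) * ((1# - q) * 1#) + q * (1# * (1# - (q * z)))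
      ≈⟨ S.solve 2 (λ q z →
           (I S.:+ q S.:* (q S.:* z)) S.:* ((I S.:- q) S.:* I) S.:+ q S.:* (I S.:* (I S.:- q S.:* z))
           S.:= I S.:* (I S.:- q S.:* (q S.:* (q S.:* z)))) ≈-refl q z ⟩
    1# * (1# - (q * (q * (q * z))))
      ≈⟨ *-cong ≈-refl (+-cong ≈-refl (-‿cong e₃)) ⟨
    1# * 1-q^ (suc (suc (suc c) ℕ.+ 0)) ∎
    where
    I : ∀ {n} → S.Polynomial n
    I = S.con 1ℤ
    q = q^ 1
    z = q^ c
    e₁ : q^ (suc (c ℕ.+ 0)) ≈ q * z
    e₁ = ≈-trans (q^-+ 1 (c ℕ.+ 0)) (*-cong ≈-refl (q^-≡ (ℕₚ.+-identityʳ c)))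
    e₂ : q^ (suc (suc c)) ≈ q * (q * z)
    e₂ = ≈-trans (q^-+ 1 (suc c)) (*-cong ≈-refl (q^-+ 1 c))
    e₃ : q^ (suc (suc (suc (c ℕ.+ 0)))) ≈ q * (q * (q * z))
    e₃ = ≈-trans (q^-+ 1 _) (*-cong ≈-refl (≈-trans (q^-+ 1 _) (*-cong ≈-refl e₁)))
  pochhammer-contiguous (suc b) c = begin
    (1# + q^ (suc (suc (B ℕ.+ (B ℕ.+ c))))) * (1-q^ (suc B) * pochhammer B (suc (B ℕ.+ c)))
      + (q^ (suc B) * pochhammer (suc B) (B ℕ.+ c) + q^ (suc (suc (B ℕ.+ c))) * nextFactor B c)
      ≈⟨ +-cong
           (*-cong (+-cong ≈-refl e₅) (*-cong (+-cong ≈-refl (-‿cong e₁)) j₁))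
           (+-cong (*-cong e₁ j₂)
             (*-cong e₃ (*-cong ≈-refl (*-cong (+-cong ≈-refl (-‿cong e₁)) ≈-refl)))) ⟩
    (1# + q * (q * (x * (x * z)))) * ((1# - (q * x)) * ((1# - (q * (q * (x * z)))) * J))
      + ((q * x) * ((1# - (q * (x * z))) * ((1# - (q * (q * (x * z)))) * J))
      + (q * (q * (x * z))) * ((1# - x) * ((1# - (q * x)) * J)))
      ≈⟨ S.solve 4 (λ q x z J →
           (I S.:+ q S.:* (q S.:* (x S.:* (x S.:* z)))) S.:* ((I S.:- (q S.:* x)) S.:* ((I S.:- (q S.:* (q S.:* (x S.:* z)))) S.:* J))
           S.:+ ((q S.:* x) S.:* ((I S.:- (q S.:* (x S.:* z))) S.:* ((I S.:- (q S.:* (q S.:* (x S.:* z)))) S.:* J))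
           S.:+ (q S.:* (q S.:* (x S.:* z))) S.:* ((I S.:- x) S.:* ((I S.:- (q S.:* x)) S.:* J)))
           S.:= (J S.:* (I S.:- (q S.:* (q S.:* (x S.:* (x S.:* z)))))) S.:* (I S.:- (q S.:* (q S.:* (q S.:* (x S.:* (x S.:* z)))))))
           ≈-refl q x z J ⟩
    (J * (1# - (q * (q * (x * (x * z)))))) * (1# - (q * (q * (q * (x * (x * z))))))
      ≈⟨ *-cong (*-cong ≈-refl (+-cong ≈-refl (-‿cong e₆))) (+-cong ≈-refl (-‿cong e₇)) ⟨
    pochhammer (suc B) (suc (suc (B ℕ.+ c))) ∎
    where
    I : ∀ {n} → S.Polynomial n
    I = S.con 1ℤ
    B = suc b
    q = q^ 1
    x = q^ B
    z = q^ c
    J = pochhammer b (suc (suc (B ℕ.+ c)))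
    suc-+ : ∀ {e f} → q^ e ≈ f → q^ (suc e) ≈ q * f
    suc-+ {e} p = ≈-trans (q^-+ 1 e) (*-cong ≈-refl p)
    e₀ : q^ (B ℕ.+ c) ≈ x * z
    e₀ = q^-+ B c
    e₁ : q^ (suc B) ≈ q * x
    e₁ = q^-+ 1 B
    e₂ : q^ (suc (B ℕ.+ c)) ≈ q * (x * z)
    e₂ = suc-+ e₀
    e₃ : q^ (suc (suc (B ℕ.+ c))) ≈ q * (q * (x * z))
    e₃ = suc-+ e₂
    e₅ : q^ (suc (suc (B ℕ.+ (B ℕ.+ c)))) ≈ q * (q * (x * (x * z)))
    e₅ = suc-+ (suc-+ (≈-trans (q^-+ B (B ℕ.+ c)) (*-cong ≈-refl e₀)))
    e₆ : q^ (suc (suc (suc (B ℕ.+ c)) ℕ.+ b)) ≈ q * (q * (x * (x * z)))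
    e₆ = ≈-trans (q^-≡ (N.solve 2 (λ b c → N.con 4 N.:+ (b N.:+ c) N.:+ b N.:= N.con 2 N.:+ (N.con 1 N.:+ b N.:+ (N.con 1 N.:+ b N.:+ c))) refl b c)) e₅
    e₇ : q^ (suc (suc (suc (B ℕ.+ c)) ℕ.+ B)) ≈ q * (q * (q * (x * (x * z))))
    e₇ = ≈-trans (q^-≡ (ℕₚ.+-suc (suc (suc (suc (B ℕ.+ c)))) b)) (suc-+ e₆)
    j₁ : pochhammer B (suc (B ℕ.+ c)) ≈ (1# - (q * (q * (x * z)))) * J
    j₁ = ≈-trans (pochhammer-front b (suc (B ℕ.+ c))) (*-cong (+-cong ≈-refl (-‿cong e₃)) ≈-refl)
    j₂ : pochhammer (suc B) (B ℕ.+ c) ≈ (1# - (q * (x * z))) * ((1# - (q * (q * (x * z)))) * J)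
    j₂ = ≈-trans (pochhammer-front B (B ℕ.+ c)) (*-cong (+-cong ≈-refl (-‿cong e₂)) j₁)

  -- Index -1 is read as 0. Both Vₖ and the weights are invariant under k ↔ -1 - k, so their values
  -- at -1 and 0 agree.
  previous : (ℕ → Carrier) → ℕ → Carrier
  previous f zero    = f zero
  previous f (suc k) = f k

  -- Defined by the effect that multiplication by (1 - qⁿ)(1 + z qⁿ + q²ⁿ), n = N + 1, has on
  -- coefficients with respect to the Vₖ. The expansion then needs only this recurrence, and the
  -- limit only the closed form `weight-product`.
  weight : ℕ → ℕ → Carrier
  weight zero    zero    = 1#
  weight zero    (suc k) = 0#
  weight (suc N) k       = 1-q^ (suc N) *
    ((1# + q^ (suc N) * q^ (suc N)) * weight N k + q^ (suc N) * (previous (weight N) k + weight N (suc k)))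

  weight-above : ∀ N k → N < k → weight N k ≈ 0#
  weight-above zero    (suc k) _         = ≈-refl
  weight-above (suc N) (suc k) (s≤s N<k) = begin
    1-q^ (suc N) * ((1# + X * X) * weight N (suc k) + X * (weight N k + weight N (suc (suc k))))
      ≈⟨ *-cong ≈-refl (+-cong (*-cong ≈-refl (weight-above N (suc k) (ℕₚ.m<n⇒m<1+n N<k)))
           (*-cong ≈-refl (+-cong (weight-above N k N<k)
             (weight-above N (suc (suc k)) (ℕₚ.m<n⇒m<1+n (ℕₚ.m<n⇒m<1+n N<k)))))) ⟩
    1-q^ (suc N) * ((1# + X * X) * 0# + X * (0# + 0#))
      ≈⟨ S.solve 2 (λ u X → u S.:* ((S.con 1ℤ S.:+ X S.:* X) S.:* S.con 0ℤ S.:+ X S.:* (S.con 0ℤ S.:+ S.con 0ℤ))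
           S.:= S.con 0ℤ) ≈-refl (1-q^ (suc N)) X ⟩
    0# ∎
    where X = q^ (suc N)

  -- For N = a + k this is (1 - q)⋯(1 - q^N) times the Gaussian binomial coefficient of 2N + 1 over
  -- a, with all denominators cancelled.
  product : ℕ → ℕ → Carrier
  product a k = pochhammer k a * pochhammer a (suc (a ℕ.+ (k ℕ.+ k)))

  weight-product : ∀ N a k → N ≡ a ℕ.+ k → weight N k ≈ product a k * q^ (tri k)
  weight-product zero zero zero refl = begin
    1#                     ≈⟨ S.solve 0 (S.con 1ℤ S.:= (S.con 1ℤ S.:* S.con 1ℤ) S.:* S.con 1ℤ) ≈-refl ⟩
    (1# * 1#) * 1#         ≈⟨ *-cong ≈-refl (≈-sym cq^-1) ⟩
    product 0 0 * q^ 0     ∎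
  -- At the top index only the neighbour `weight N N` is nonzero.
  weight-product (suc N) zero (suc .N) refl = begin
    u * ((1# + X * X) * weight N (suc N) + X * (weight N N + weight N (suc (suc N))))
      ≈⟨ *-cong ≈-refl (+-cong (*-cong ≈-refl (weight-above N (suc N) ℕₚ.≤-refl))
           (*-cong ≈-refl (+-cong (weight-product N zero N refl)
             (weight-above N (suc (suc N)) (ℕₚ.m<n⇒m<1+n ℕₚ.≤-refl))))) ⟩
    u * ((1# + X * X) * 0# + X * ((pochhammer N 0 * 1#) * q^ (tri N) + 0#))
      ≈⟨ S.solve 4 (λ u X h t → u S.:* ((S.con 1ℤ S.:+ X S.:* X) S.:* S.con 0ℤ S.:+ X S.:* ((h S.:* S.con 1ℤ) S.:* t S.:+ S.con 0ℤ))
           S.:= ((h S.:* u) S.:* S.con 1ℤ) S.:* (t S.:* X)) ≈-refl u X (pochhammer N 0) (q^ (tri N)) ⟩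
    ((pochhammer N 0 * u) * 1#) * (q^ (tri N) * X)
      ≈⟨ *-cong ≈-refl (q^-+ (tri N) (suc N)) ⟨
    product 0 (suc N) * q^ (tri (suc N)) ∎
    where
    u = 1-q^ (suc N)
    X = q^ (suc N)
  weight-product (suc N) (suc b) k eq = begin
    u * ((1# + X * X) * weight N k + X * (previous (weight N) k + weight N (suc k)))
      ≈⟨ S.solve 5 (λ u X w p n →
           u S.:* ((S.con 1ℤ S.:+ X S.:* X) S.:* w S.:+ X S.:* (p S.:+ n))
           S.:= (S.con 1ℤ S.:+ X S.:* X) S.:* (u S.:* w) S.:+ (u S.:* (X S.:* p) S.:+ u S.:* (X S.:* n)))
           ≈-refl u X (weight N k) (previous (weight N) k) (weight N (suc k)) ⟩
    (1# + X * X) * (u * weight N k) + (u * (X * previous (weight N) k) + u * (X * weight N (suc k)))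
      -- Each of the three neighbouring weights is brought to the common factor `H` and the common
      -- power `t`; the cofactors `A₁`, `A₂`, `A₃` are those of `pochhammer-contiguous`.
      ≈⟨ +-cong (*-cong (+-cong ≈-refl X²) same) (+-cong (before k N≡) (after b N≡)) ⟩
    (1# + Q) * ((H * A₁) * t) + ((H * A₂) * t + (H * A₃) * t)
      ≈⟨ S.solve 6 (λ Q H t a b c →
           (S.con 1ℤ S.:+ Q) S.:* ((H S.:* a) S.:* t) S.:+ ((H S.:* b) S.:* t S.:+ (H S.:* c) S.:* t)
           S.:= (H S.:* ((S.con 1ℤ S.:+ Q) S.:* a S.:+ (b S.:+ c))) S.:* t)
           ≈-refl Q H t A₁ A₂ A₃ ⟩
    (H * ((1# + Q) * A₁ + (A₂ + A₃))) * t
      ≈⟨ *-cong (*-cong ≈-refl (pochhammer-contiguous b (k ℕ.+ k))) ≈-refl ⟩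
    product (suc b) k * t ∎
    where
    N≡ : N ≡ b ℕ.+ k
    N≡ = ℕₚ.suc-injective eq
    u = 1-q^ (suc N)
    X = q^ (suc N)
    t = q^ (tri k)
    H = pochhammer k (suc b)
    Q = q^ (suc (suc (b ℕ.+ (b ℕ.+ (k ℕ.+ k)))))
    A₁ = 1-q^ (suc b) * pochhammer b (suc (b ℕ.+ (k ℕ.+ k)))
    A₂ = q^ (suc b) * pochhammer (suc b) (b ℕ.+ (k ℕ.+ k))
    A₃ = q^ (suc (suc (b ℕ.+ (k ℕ.+ k)))) * nextFactor b (k ℕ.+ k)

    X² : X * X ≈ Q
    X² = ≈-trans (≈-sym (q^-+ (suc N) (suc N))) (q^-≡ (trans (cong (λ n → suc n ℕ.+ suc n) N≡)
      (N.solve 2 (λ b k → (N.con 1 N.:+ (b N.:+ k)) N.:+ (N.con 1 N.:+ (b N.:+ k))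
        N.:= N.con 2 N.:+ (b N.:+ (b N.:+ (k N.:+ k)))) refl b k)))

    same : u * weight N k ≈ (H * A₁) * t
    same = begin
      u * weight N k
        ≈⟨ *-cong (1-q^-≡ (cong suc N≡)) (weight-product N b k N≡) ⟩
      1-q^ (suc (b ℕ.+ k)) * ((pochhammer k b * G) * t)
        ≈⟨ S.solve 4 (λ u h g t → u S.:* ((h S.:* g) S.:* t) S.:= ((h S.:* u) S.:* g) S.:* t)
             ≈-refl _ (pochhammer k b) G t ⟩
      (pochhammer (suc k) b * G) * t
        ≈⟨ *-cong (*-cong (pochhammer-front k b) ≈-refl) ≈-refl ⟩
      ((1-q^ (suc b) * H) * G) * t
        ≈⟨ S.solve 4 (λ d h g t → ((d S.:* h) S.:* g) S.:* t S.:= (h S.:* (d S.:* g)) S.:* t)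
             ≈-refl (1-q^ (suc b)) H G t ⟩
      (H * A₁) * t ∎
      where G = pochhammer b (suc (b ℕ.+ (k ℕ.+ k)))

    before : ∀ k → N ≡ b ℕ.+ k → u * (X * previous (weight N) k) ≈
             (pochhammer k (suc b) * (q^ (suc b) * pochhammer (suc b) (b ℕ.+ (k ℕ.+ k)))) * q^ (tri k)
    -- At k = 0 the reflected term is `weight N 0` itself. The factor `u` extends its Pochhammer
    -- product downwards by one, which gives the same shape as for k > 0.
    before zero N≡ = begin
      u * (X * weight N 0)
        ≈⟨ *-cong (1-q^-≡ (cong suc N≡)) (*-cong (q^-≡ (cong suc (trans N≡ (ℕₚ.+-identityʳ b)))) (weight-product N b 0 N≡)) ⟩
      v * (q^ (suc b) * ((1# * pochhammer b (suc (b ℕ.+ 0))) * q^ 0))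
        ≈⟨ S.solve 4 (λ v x g t → v S.:* (x S.:* ((S.con 1ℤ S.:* g) S.:* t)) S.:= (S.con 1ℤ S.:* (x S.:* (v S.:* g))) S.:* t)
             ≈-refl v (q^ (suc b)) _ (q^ 0) ⟩
      (1# * (q^ (suc b) * (v * pochhammer b (suc (b ℕ.+ 0))))) * q^ 0
        ≈⟨ *-cong (*-cong ≈-refl (*-cong ≈-refl (pochhammer-front b (b ℕ.+ 0)))) ≈-refl ⟨
      (1# * (q^ (suc b) * pochhammer (suc b) (b ℕ.+ 0))) * q^ 0 ∎
      where v = 1-q^ (suc (b ℕ.+ 0))
    before (suc j) N≡ = begin
      u * (X * weight N j)
        ≈⟨ *-cong (1-q^-≡ (cong suc N≡′)) (*-cong (≈-trans (q^-≡ (cong suc N≡)) (q^-+ (suc b) (suc j)))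
             (≈-trans (weight-product N (suc b) j N≡′)
               (*-cong (*-cong ≈-refl (pochhammer-≡ (suc b) index)) ≈-refl))) ⟩
      v * ((q^ (suc b) * y) * ((h * G) * q^ (tri j)))
        ≈⟨ S.solve 6 (λ v x y h g t → v S.:* ((x S.:* y) S.:* ((h S.:* g) S.:* t))
             S.:= ((h S.:* v) S.:* (x S.:* g)) S.:* (t S.:* y)) ≈-refl v (q^ (suc b)) y h G (q^ (tri j)) ⟩
      (pochhammer (suc j) (suc b) * (q^ (suc b) * G)) * (q^ (tri j) * y)
        ≈⟨ *-cong ≈-refl (q^-+ (tri j) (suc j)) ⟨
      (pochhammer (suc j) (suc b) * (q^ (suc b) * G)) * q^ (tri (suc j)) ∎
      where
      N≡′ : N ≡ suc b ℕ.+ j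
      N≡′ = trans N≡ (ℕₚ.+-suc b j)
      v = 1-q^ (suc (suc b ℕ.+ j))
      y = q^ (suc j)
      h = pochhammer j (suc b)
      G = pochhammer (suc b) (b ℕ.+ (suc j ℕ.+ suc j))
      index : suc (suc b ℕ.+ (j ℕ.+ j)) ≡ b ℕ.+ (suc j ℕ.+ suc j)
      index = N.solve 2 (λ b j → N.con 2 N.:+ (b N.:+ (j N.:+ j)) N.:= b N.:+ ((N.con 1 N.:+ j) N.:+ (N.con 1 N.:+ j))) refl b j

    after : ∀ b → N ≡ b ℕ.+ k → u * (X * weight N (suc k)) ≈
            (pochhammer k (suc b) * (q^ (suc (suc (b ℕ.+ (k ℕ.+ k)))) * nextFactor b (k ℕ.+ k))) * t
    after zero refl = begin
      u * (X * weight N (suc k))  ≈⟨ *-cong ≈-refl (*-cong ≈-refl (weight-above N (suc k) ℕₚ.≤-refl)) ⟩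
      u * (X * 0#)
        ≈⟨ S.solve 5 (λ u X h x t → u S.:* (X S.:* S.con 0ℤ) S.:= (h S.:* (x S.:* S.con 0ℤ)) S.:* t)
             ≈-refl u X (pochhammer k 1) _ t ⟩
      (pochhammer k 1 * (q^ (suc (suc (k ℕ.+ k))) * 0#)) * t ∎
    after (suc d) N≡ = begin
      u * (X * weight N (suc k))
        ≈⟨ *-cong (1-q^-≡ (cong suc N≡′)) (*-cong ≈-refl
             (≈-trans (weight-product N d (suc k) N≡′)
               (*-cong (*-cong ≈-refl (pochhammer-≡ d index)) (q^-+ (tri k) (suc k))))) ⟩
      v * (X * ((pochhammer (suc k) d * G) * (t * q^ (suc k))))
        ≈⟨ S.solve 6 (λ v X h g t y → v S.:* (X S.:* ((h S.:* g) S.:* (t S.:* y)))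
             S.:= ((h S.:* v) S.:* ((X S.:* y) S.:* g)) S.:* t) ≈-refl v X (pochhammer (suc k) d) G t (q^ (suc k)) ⟩
      (pochhammer (suc (suc k)) d * ((X * q^ (suc k)) * G)) * t
        ≈⟨ *-cong (*-cong
             (≈-trans (pochhammer-front (suc k) d) (*-cong ≈-refl (pochhammer-front k (suc d))))
             (*-cong X* ≈-refl)) ≈-refl ⟩
      ((1-q^ (suc d) * (1-q^ (suc (suc d)) * h)) * (x * G)) * t
        ≈⟨ S.solve 6 (λ v w h x g t → ((v S.:* (w S.:* h)) S.:* (x S.:* g)) S.:* t
             S.:= (h S.:* (x S.:* (v S.:* (w S.:* g)))) S.:* t)
             ≈-refl (1-q^ (suc d)) (1-q^ (suc (suc d))) h x G t ⟩
      (h * (x * nextFactor (suc d) (k ℕ.+ k))) * t ∎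
      where
      N≡′ : N ≡ d ℕ.+ suc k
      N≡′ = trans N≡ (sym (ℕₚ.+-suc d k))
      v = 1-q^ (suc (d ℕ.+ suc k))
      h = pochhammer k (suc (suc d))
      x = q^ (suc (suc (suc d ℕ.+ (k ℕ.+ k))))
      G = pochhammer d (suc (suc (suc d ℕ.+ (k ℕ.+ k))))
      index : suc (d ℕ.+ (suc k ℕ.+ suc k)) ≡ suc (suc (suc d ℕ.+ (k ℕ.+ k)))
      index = N.solve 2 (λ d k → N.con 1 N.:+ (d N.:+ ((N.con 1 N.:+ k) N.:+ (N.con 1 N.:+ k))) N.:= N.con 3 N.:+ (d N.:+ (k N.:+ k))) refl d k
      X* : X * q^ (suc k) ≈ x
      X* = ≈-trans (≈-sym (q^-+ (suc N) (suc k))) (q^-≡ (trans (cong (λ n → suc n ℕ.+ suc k) N≡)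
        (N.solve 2 (λ d k → N.con 2 N.:+ (d N.:+ k) N.:+ (N.con 1 N.:+ k) N.:= N.con 3 N.:+ (d N.:+ (k N.:+ k))) refl d k)))

  -- The weights modulo q^M

  1-q^-absorbed : ∀ {d e} → M ≤ d ℕ.+ e → 1-q^ d * q^ e ≈ q^ e
  1-q^-absorbed {d} {e} M≤d+e = begin
    (1# - q^ d) * q^ e         ≈⟨ S.solve 2 (λ x y → (S.con 1ℤ S.:- x) S.:* y S.:= y S.:- (x S.:* y)) ≈-refl (q^ d) (q^ e) ⟩
    q^ e - q^ d * q^ e         ≈⟨ +-cong ≈-refl (-‿cong (≈-trans (≈-sym (q^-+ d e)) (cq^-vanishes 1ℤ M≤d+e))) ⟩
    q^ e - 0#                  ≈⟨ S.solve 1 (λ y → y S.:- S.con 0ℤ S.:= y) ≈-refl (q^ e) ⟩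
    q^ e                       ∎

  pochhammer-absorbed : ∀ m {b e} → M ≤ suc b ℕ.+ e → pochhammer m b * q^ e ≈ q^ e
  pochhammer-absorbed zero            _   = *-identityˡ _
  pochhammer-absorbed (suc m) {b} {e} M≤ = begin
    (pochhammer m b * 1-q^ (suc (b ℕ.+ m))) * q^ e  ≈⟨ *-assoc _ _ _ ⟩
    pochhammer m b * (1-q^ (suc (b ℕ.+ m)) * q^ e)
      ≈⟨ *-cong ≈-refl (1-q^-absorbed (ℕₚ.≤-trans M≤ (ℕₚ.+-monoˡ-≤ e (s≤s (ℕₚ.m≤m+n b m))))) ⟩
    pochhammer m b * q^ e                           ≈⟨ pochhammer-absorbed m M≤ ⟩
    q^ e                                            ∎

  -- The factors 1 - qʲ of the weight are not all trivial modulo q^M, since j can be as low as N - k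
  -- + 1. They become so next to `q^ (tri k)`: as `tri k` is at least k, j + `tri k` is at least N +
  -- 1.
  weight-limit : ∀ {N} k → M ≤ suc N → k ≤ N → weight N k ≈ q^ (tri k)
  weight-limit {N} k M≤1+N k≤N = begin
    weight N k  ≈⟨ weight-product N d k (sym (ℕₚ.m∸n+n≡m k≤N)) ⟩
    (pochhammer k d * pochhammer d (suc (d ℕ.+ (k ℕ.+ k)))) * q^ (tri k)  ≈⟨ *-assoc _ _ _ ⟩
    pochhammer k d * (pochhammer d (suc (d ℕ.+ (k ℕ.+ k))) * q^ (tri k))
      ≈⟨ *-cong ≈-refl (pochhammer-absorbed d (ℕₚ.≤-trans M≤ (ℕₚ.+-monoˡ-≤ (tri k)
           (s≤s (ℕₚ.m≤n⇒m≤1+n (ℕₚ.m≤m+n d (k ℕ.+ k))))))) ⟩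
    pochhammer k d * q^ (tri k)  ≈⟨ pochhammer-absorbed k M≤ ⟩
    q^ (tri k)                   ∎
    where
    d = N ℕ.∸ k
    M≤ : M ≤ suc d ℕ.+ tri k
    M≤ = ℕₚ.≤-trans M≤1+N (subst (λ n → suc n ≤ suc d ℕ.+ tri k) (ℕₚ.m∸n+n≡m k≤N)
           (s≤s (ℕₚ.+-monoʳ-≤ d (n≤tri k))))

  -- Expansion of the product in the polynomials Vₖ

  ∑< : ℕ → (ℕ → Carrier) → Carrier
  ∑< zero    f = 0#
  ∑< (suc n) f = ∑< n f + f n

  ∑<-cong : ∀ n {f g} → (∀ k → k < n → f k ≈ g k) → ∑< n f ≈ ∑< n g
  ∑<-cong zero    p = ≈-refl
  ∑<-cong (suc n) p = +-cong (∑<-cong n λ k k<n → p k (ℕₚ.m<n⇒m<1+n k<n)) (p n ℕₚ.≤-refl)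

  ∑<-0 : ∀ n {f} → (∀ k → f k ≈ 0#) → ∑< n f ≈ 0#
  ∑<-0 zero    p = ≈-refl
  ∑<-0 (suc n) p = ≈-trans (+-cong (∑<-0 n p) (p n)) (+-identityˡ 0#)

  ∑<-bottom : ∀ n f → ∑< (suc n) f ≈ f 0 + ∑< n (f ∘ suc)
  ∑<-bottom zero    f = +-comm 0# (f 0)
  ∑<-bottom (suc n) f = ≈-trans (+-cong (∑<-bottom n f) ≈-refl) (+-assoc _ _ _)

  -- Moves the neighbour sum from v to w. The convention of `previous` makes the boundary terms at k
  -- = 0 cancel, so only those at the upper end appear.
  summation-by-parts : ∀ {v v′ : ℕ → Carrier} (w : ℕ → Carrier) →
    (∀ k → v (suc k) + previous v k ≈ v′ k) → ∀ n →
    ∑< (suc n) (λ k → (previous w k + w (suc k)) * v k) + w n * v (suc n) ≈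
    ∑< (suc n) (λ k → w k * v′ k) + w (suc n) * v n
  summation-by-parts {v} {v′} w rec zero = begin
    (0# + (w 0 + w 1) * v 0) + w 0 * v 1
      ≈⟨ S.solve 4 (λ a b x y → (S.con 0ℤ S.:+ (a S.:+ b) S.:* x) S.:+ a S.:* y
           S.:= (S.con 0ℤ S.:+ a S.:* (y S.:+ x)) S.:+ b S.:* x) ≈-refl (w 0) (w 1) (v 0) (v 1) ⟩
    (0# + w 0 * (v 1 + v 0)) + w 1 * v 0
      ≈⟨ +-cong (+-cong ≈-refl (*-cong ≈-refl (rec 0))) ≈-refl ⟩
    (0# + w 0 * v′ 0) + w 1 * v 0 ∎
  summation-by-parts {v} {v′} w rec (suc n) = begin
    (s + (w n + w (suc (suc n))) * v (suc n)) + w (suc n) * v (suc (suc n))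
      ≈⟨ S.solve 6 (λ s a b c x y → (s S.:+ (a S.:+ c) S.:* x) S.:+ b S.:* y
           S.:= (s S.:+ a S.:* x) S.:+ (b S.:* y S.:+ c S.:* x)) ≈-refl s (w n) (w (suc n)) (w (suc (suc n))) (v (suc n)) (v (suc (suc n))) ⟩
    (s + w n * v (suc n)) + (w (suc n) * v (suc (suc n)) + w (suc (suc n)) * v (suc n))
      ≈⟨ +-cong (summation-by-parts w rec n) ≈-refl ⟩
    (s′ + w (suc n) * v n) + (w (suc n) * v (suc (suc n)) + w (suc (suc n)) * v (suc n))
      ≈⟨ S.solve 6 (λ s b c x y z → (s S.:+ b S.:* x) S.:+ (b S.:* z S.:+ c S.:* y)
           S.:= (s S.:+ b S.:* (z S.:+ x)) S.:+ c S.:* y) ≈-refl s′ (w (suc n)) (w (suc (suc n))) (v n) (v (suc n)) (v (suc (suc n))) ⟩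
    (s′ + w (suc n) * (v (suc (suc n)) + v n)) + w (suc (suc n)) * v (suc n)
      ≈⟨ +-cong (+-cong ≈-refl (*-cong ≈-refl (rec (suc n)))) ≈-refl ⟩
    (s′ + w (suc n) * v′ (suc n)) + w (suc (suc n)) * v (suc n) ∎
    where
    s  = ∑< (suc n) (λ k → (previous w k + w (suc k)) * v k)
    s′ = ∑< (suc n) (λ k → w k * v′ k)

  -- Multiplication by z on sequences of coefficients of powers of z.
  z· : (ℕ → Carrier) → ℕ → Carrier
  z· f zero    = 0#
  z· f (suc j) = f j

  V : ℕ → ℕ → Carrier
  V k j = cq^ (V-coeff k j) 0

  V-recurrence : ∀ j k → V (suc k) j + previous (λ i → V i j) k ≈ z· (V k) j
  V-recurrence zero          zero    = ≈-trans (≈-sym (cq^-+ -1ℤ 1ℤ 0)) (cq^-0 0)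
  V-recurrence (suc zero)    zero    = ≈-sym (cq^-+ 1ℤ 0ℤ 0)
  V-recurrence (suc (suc j)) zero    = ≈-sym (cq^-+ 0ℤ 0ℤ 0)
  V-recurrence zero          (suc k) = ≈-trans (≈-sym (cq^-+ (ℤ.- V-coeff k 0) (V-coeff k 0) 0))
    (≈-trans (≈-reflexive (cong (λ c → cq^ c 0) (ℤₚ.+-inverseˡ (V-coeff k 0)))) (cq^-0 0))
  V-recurrence (suc j)       (suc k) = ≈-trans (≈-sym (cq^-+ (V-coeff (suc k) j ℤ.- V-coeff k (suc j)) (V-coeff k (suc j)) 0))
    (≈-reflexive (cong (λ c → cq^ c 0) (solve 2 (λ a b → (a :- b) :+ b := a) refl (V-coeff (suc k) j) (V-coeff k (suc j)))))
    where open +-*-Solver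

  -- The coefficient of zʲ in ∏ₙ (1 − qⁿ)(1 + z qⁿ + q²ⁿ), 1 ≤ n ≤ N.
  thetaProduct : ℕ → ℕ → Carrier
  thetaProduct zero    zero    = 1#
  thetaProduct zero    (suc j) = 0#
  thetaProduct (suc N) j       = 1-q^ (suc N) *
    ((1# + q^ (suc N) * q^ (suc N)) * thetaProduct N j + q^ (suc N) * z· (thetaProduct N) j)

  -- The range L is left free because the step from N to N + 1 uses the hypothesis on the longer
  -- range. There the boundary terms of the summation by parts carry weights of index above N and
  -- vanish.
  thetaProduct-expansion : ∀ N L j → N < L → thetaProduct N j ≈ ∑< L (λ k → weight N k * V k j)
  thetaProduct-expansion zero (suc L) j _ = begin
    thetaProduct 0 j                        ≈⟨ initial j ⟩
    V 0 j                                   ≈⟨ S.solve 1 (λ x → x S.:= S.con 1ℤ S.:* x S.:+ S.con 0ℤ) ≈-refl (V 0 j) ⟩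
    1# * V 0 j + 0#                         ≈⟨ +-cong ≈-refl (∑<-0 L λ k → zeroˡ _) ⟨
    1# * V 0 j + ∑< L (λ k → 0# * V (suc k) j)
                                            ≈⟨ ∑<-bottom L (λ k → weight 0 k * V k j) ⟨
    ∑< (suc L) (λ k → weight 0 k * V k j)   ∎
    where
    initial : ∀ j → thetaProduct 0 j ≈ V 0 j
    initial zero    = ≈-sym cq^-1
    initial (suc j) = ≈-sym (cq^-0 0)
  thetaProduct-expansion (suc N) (suc L) j (s≤s N<L) = begin
    u * ((1# + X * X) * thetaProduct N j + X * z· (thetaProduct N) j)
      ≈⟨ *-cong ≈-refl (+-cong (*-cong ≈-refl (thetaProduct-expansion N (suc L) j (ℕₚ.m<n⇒m<1+n N<L)))
           (*-cong ≈-refl (≈-trans (shifted j) (≈-sym parts)))) ⟩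
    u * ((1# + X * X) * ∑< (suc L) (λ k → w k * V k j) + X * ∑< (suc L) (λ k → (previous w k + w (suc k)) * V k j))
      ≈⟨ linear (suc L) ⟨
    ∑< (suc L) (λ k → weight (suc N) k * V k j) ∎
    where
    u = 1-q^ (suc N)
    X = q^ (suc N)
    w = weight N
    linear : ∀ n → ∑< n (λ k → weight (suc N) k * V k j) ≈
      u * ((1# + X * X) * ∑< n (λ k → w k * V k j) + X * ∑< n (λ k → (previous w k + w (suc k)) * V k j))
    linear zero = S.solve 2 (λ u X → S.con 0ℤ S.:=
      u S.:* ((S.con 1ℤ S.:+ X S.:* X) S.:* S.con 0ℤ S.:+ X S.:* S.con 0ℤ)) ≈-refl u X
    linear (suc n) = ≈-trans (+-cong (linear n) ≈-refl)
      (S.solve 7 (λ u X s s′ w w′ y →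
        u S.:* ((S.con 1ℤ S.:+ X S.:* X) S.:* s S.:+ X S.:* s′) S.:+ (u S.:* ((S.con 1ℤ S.:+ X S.:* X) S.:* w S.:+ X S.:* w′)) S.:* y
        S.:= u S.:* ((S.con 1ℤ S.:+ X S.:* X) S.:* (s S.:+ w S.:* y) S.:+ X S.:* (s′ S.:+ w′ S.:* y)))
        ≈-refl u X _ _ (w n) (previous w n + w (suc n)) (V n j))
    shifted : ∀ j → z· (thetaProduct N) j ≈ ∑< (suc L) (λ k → w k * z· (V k) j)
    shifted zero    = ≈-sym (∑<-0 (suc L) λ k → zeroʳ _)
    shifted (suc j) = thetaProduct-expansion N (suc L) j (ℕₚ.m<n⇒m<1+n N<L)
    parts : ∑< (suc L) (λ k → (previous w k + w (suc k)) * V k j) ≈ ∑< (suc L) (λ k → w k * z· (V k) j)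
    parts = begin
      s                           ≈⟨ S.solve 2 (λ s y → s S.:= s S.:+ S.con 0ℤ S.:* y) ≈-refl s (V (suc L) j) ⟩
      s + 0# * V (suc L) j        ≈⟨ +-cong ≈-refl (*-cong (weight-above N L N<L) ≈-refl) ⟨
      s + w L * V (suc L) j       ≈⟨ summation-by-parts w (V-recurrence j) L ⟩
      s′ + w (suc L) * V L j      ≈⟨ +-cong ≈-refl (*-cong (weight-above N (suc L) (ℕₚ.m<n⇒m<1+n N<L)) ≈-refl) ⟩
      s′ + 0# * V L j             ≈⟨ S.solve 2 (λ s y → s S.:+ S.con 0ℤ S.:* y S.:= s) ≈-refl s′ (V L j) ⟩
      s′                          ∎
      where
      s  = ∑< (suc L) (λ k → (previous w k + w (suc k)) * V k j)
      s′ = ∑< (suc L) (λ k → w k * z· (V k) j)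

  thetaProduct-limit : ∀ N j → M ≤ suc N → thetaProduct N j ≈ ∑< (suc N) (λ k → cq^ (V-coeff k j) (tri k))
  thetaProduct-limit N j M≤1+N = ≈-trans (thetaProduct-expansion N (suc N) j ℕₚ.≤-refl)
    (∑<-cong (suc N) λ { k (s≤s k≤N) → begin
      weight N k * V k j           ≈⟨ *-cong (weight-limit k M≤1+N k≤N) ≈-refl ⟩
      q^ (tri k) * V k j           ≈⟨ *-comm _ _ ⟩
      cq^ (V-coeff k j) 0 * q^ (tri k)   ≈⟨ cq^-* (V-coeff k j) 1ℤ 0 (tri k) ⟨
      cq^ (V-coeff k j ℤ.* 1ℤ) (tri k)   ≈⟨ ≈-reflexive (cong (λ c → cq^ c (tri k)) (ℤₚ.*-identityʳ (V-coeff k j))) ⟩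
      cq^ (V-coeff k j) (tri k)          ∎ })

  -- Elementary symmetric polynomials in the qⁿ / (1 + q²ⁿ)

  -- ξ n = qⁿ / (1 + q²ⁿ)
  ξ : ℕ → Carrier
  ξ n = ∑< M (λ r → cq^ (-1ℤ ℤ.^ r) ((2 ℕ.* r ℕ.+ 1) ℕ.* n))

  ξ-inverse : ∀ n → (1# + q^ (suc n) * q^ (suc n)) * ξ (suc n) ≈ q^ (suc n)
  ξ-inverse n = begin
    (1# + X * X) * ξ (suc n)          ≈⟨ +-identityʳ _ ⟨
    -- The next term `t M` of the geometric series is zero modulo q^M, and adding it makes the
    -- truncated sum telescope.
    (1# + X * X) * ξ (suc n) + 0#     ≈⟨ +-cong ≈-refl (cq^-vanishes _ M≤) ⟨
    (1# + X * X) * ξ (suc n) + t M    ≈⟨ telescope M ⟩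
    X                                 ∎
    where
    X = q^ (suc n)
    t : ℕ → Carrier
    t r = cq^ (-1ℤ ℤ.^ r) ((2 ℕ.* r ℕ.+ 1) ℕ.* suc n)
    M≤ : M ≤ (2 ℕ.* M ℕ.+ 1) ℕ.* suc n
    M≤ = ℕₚ.≤-trans (ℕₚ.≤-trans (ℕₚ.m≤m+n M (M ℕ.+ 0)) (ℕₚ.m≤m+n (2 ℕ.* M) 1)) (ℕₚ.m≤m*n (2 ℕ.* M ℕ.+ 1) (suc n))
    t-suc : ∀ r → t (suc r) ≈ - ((X * X) * t r)
    t-suc r = begin
      cq^ (-1ℤ ℤ.* (-1ℤ ℤ.^ r)) ((2 ℕ.* suc r ℕ.+ 1) ℕ.* suc n)
        ≈⟨ ≈-reflexive (cong₂ cq^ (trans (ℤₚ.-1*i≡-i (-1ℤ ℤ.^ r)) (cong ℤ.-_ (sym (ℤₚ.*-identityˡ (-1ℤ ℤ.^ r)))))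
             (N.solve 2 (λ r m → (N.con 2 N.:* (N.con 1 N.:+ r) N.:+ N.con 1) N.:* m
               N.:= (m N.:+ m) N.:+ (N.con 2 N.:* r N.:+ N.con 1) N.:* m) refl r (suc n))) ⟩
      cq^ (ℤ.- (1ℤ ℤ.* (-1ℤ ℤ.^ r))) ((suc n ℕ.+ suc n) ℕ.+ (2 ℕ.* r ℕ.+ 1) ℕ.* suc n)
        ≈⟨ cq^-neg _ _ ⟩
      - cq^ (1ℤ ℤ.* (-1ℤ ℤ.^ r)) ((suc n ℕ.+ suc n) ℕ.+ (2 ℕ.* r ℕ.+ 1) ℕ.* suc n)
        ≈⟨ -‿cong (≈-trans (cq^-* 1ℤ (-1ℤ ℤ.^ r) (suc n ℕ.+ suc n) _) (*-cong (q^-+ (suc n) (suc n)) ≈-refl)) ⟩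
      - ((X * X) * t r) ∎
    telescope : ∀ R → (1# + X * X) * ∑< R t + t R ≈ X
    telescope zero = ≈-trans (≈-trans (+-cong (zeroʳ _) ≈-refl) (+-identityˡ _)) (q^-≡ (ℕₚ.*-identityˡ (suc n)))
    telescope (suc R) = begin
      (1# + X * X) * (∑< R t + t R) + t (suc R)           ≈⟨ +-cong ≈-refl (t-suc R) ⟩
      (1# + X * X) * (∑< R t + t R) - (X * X) * t R
        ≈⟨ S.solve 3 (λ X s t → (S.con 1ℤ S.:+ X S.:* X) S.:* (s S.:+ t) S.:- (X S.:* X) S.:* t
             S.:= (S.con 1ℤ S.:+ X S.:* X) S.:* s S.:+ t) ≈-refl X (∑< R t) (t R) ⟩
      (1# + X * X) * ∑< R t + t R                         ≈⟨ telescope R ⟩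
      X                                                   ∎

  -- The j-th elementary symmetric polynomial in ξ 1, …, ξ N.
  elementary : ℕ → ℕ → Carrier
  elementary zero    zero    = 1#
  elementary zero    (suc j) = 0#
  elementary (suc N) j       = elementary N j + ξ (suc N) * z· (elementary N) j

  ∏≤ : ℕ → (ℕ → Carrier) → Carrier
  ∏≤ zero    f = 1#
  ∏≤ (suc N) f = ∏≤ N f * f (suc N)

  denominator : ℕ → Carrier
  denominator N = ∏≤ N (λ n → 1-q^ n * (1# + q^ n * q^ n))

  -- Instead of dividing by 1 + q²ⁿ, `ξ-inverse` rewrites qⁿ as (1 + q²ⁿ) ξ n, after which 1 + q²ⁿ
  -- comes out of the factor.
  thetaProduct-elementary : ∀ N j → thetaProduct N j ≈ denominator N * elementary N j
  thetaProduct-elementary zero    zero    = ≈-sym (*-identityˡ 1#)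
  thetaProduct-elementary zero    (suc j) = ≈-sym (*-identityˡ 0#)
  thetaProduct-elementary (suc N) j = begin
    u * (Y * thetaProduct N j + X * z· (thetaProduct N) j)
      ≈⟨ *-cong ≈-refl (+-cong (*-cong ≈-refl (thetaProduct-elementary N j)) (*-cong (≈-sym (ξ-inverse N)) (shifted j))) ⟩
    u * (Y * (D * elementary N j) + (Y * ξ (suc N)) * (D * z· (elementary N) j))
      ≈⟨ S.solve 6 (λ u Y D e x e′ → u S.:* (Y S.:* (D S.:* e) S.:+ (Y S.:* x) S.:* (D S.:* e′))
           S.:= (D S.:* (u S.:* Y)) S.:* (e S.:+ x S.:* e′))
           ≈-refl u Y D (elementary N j) (ξ (suc N)) (z· (elementary N) j) ⟩
    (D * (u * Y)) * (elementary N j + ξ (suc N) * z· (elementary N) j) ∎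
    where
    u = 1-q^ (suc N)
    X = q^ (suc N)
    Y = 1# + X * X
    D = denominator N
    shifted : ∀ j → z· (thetaProduct N) j ≈ D * z· (elementary N) j
    shifted zero    = ≈-sym (zeroʳ D)
    shifted (suc j) = thetaProduct-elementary N j

  ∑ : {X : Set} → List X → (X → Carrier) → Carrier
  ∑ []       f = 0#
  ∑ (t ∷ ts) f = f t + ∑ ts f

  ∑-cong : ∀ {X : Set} (ts : List X) {f g} → (∀ t → f t ≈ g t) → ∑ ts f ≈ ∑ ts g
  ∑-cong []       p = ≈-refl
  ∑-cong (t ∷ ts) p = +-cong (p t) (∑-cong ts p)

  ∑-++ : ∀ {X : Set} (ts us : List X) f → ∑ (ts ++ us) f ≈ ∑ ts f + ∑ us f
  ∑-++ []       us f = ≈-sym (+-identityˡ _)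
  ∑-++ (t ∷ ts) us f = ≈-trans (+-cong ≈-refl (∑-++ ts us f)) (≈-sym (+-assoc _ _ _))

  ∑-map : ∀ {X Y : Set} (g : X → Y) ts f → ∑ (map g ts) f ≈ ∑ ts (f ∘ g)
  ∑-map g []       f = ≈-refl
  ∑-map g (t ∷ ts) f = +-cong ≈-refl (∑-map g ts f)

  ∑-cartesianProduct : ∀ {X Y : Set} (ts : List X) (us : List Y) f →
    ∑ (cartesianProduct ts us) f ≈ ∑ ts (λ t → ∑ us (λ u → f (t , u)))
  ∑-cartesianProduct []       us f = ≈-refl
  ∑-cartesianProduct (t ∷ ts) us f = ≈-trans (∑-++ (map (t ,_) us) _ f)
    (+-cong (∑-map (t ,_) us f) (∑-cartesianProduct ts us f))

  ∑-applyUpTo : ∀ (g : ℕ → ℕ) n f → ∑ (applyUpTo g n) f ≈ ∑< n (f ∘ g)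
  ∑-applyUpTo g zero    f = ≈-refl
  ∑-applyUpTo g (suc n) f = ≈-trans (+-cong ≈-refl (∑-applyUpTo (g ∘ suc) n f)) (≈-sym (∑<-bottom n (f ∘ g)))

  *-distribˡ-∑ : ∀ {X : Set} c (ts : List X) f → c * ∑ ts f ≈ ∑ ts (λ t → c * f t)
  *-distribˡ-∑ c []       f = zeroʳ c
  *-distribˡ-∑ c (t ∷ ts) f = ≈-trans (distribˡ c (f t) (∑ ts f)) (+-cong ≈-refl (*-distribˡ-∑ c ts f))

  *-distribʳ-∑ : ∀ {X : Set} c (ts : List X) f → ∑ ts f * c ≈ ∑ ts (λ t → f t * c)
  *-distribʳ-∑ c ts f = ≈-trans (*-comm _ _) (≈-trans (*-distribˡ-∑ c ts f) (∑-cong ts λ t → *-comm _ _))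

  ∑-product : ∀ {X Y : Set} (ts : List X) (us : List Y) f g →
    ∑ (cartesianProduct ts us) (λ (t , u) → f t * g u) ≈ ∑ ts f * ∑ us g
  ∑-product ts us f g = begin
    ∑ (cartesianProduct ts us) (λ (t , u) → f t * g u)  ≈⟨ ∑-cartesianProduct ts us _ ⟩
    ∑ ts (λ t → ∑ us (λ u → f t * g u))                 ≈⟨ ∑-cong ts (λ t → ≈-sym (*-distribˡ-∑ (f t) us g)) ⟩
    ∑ ts (λ t → f t * ∑ us g)                           ≈⟨ *-distribʳ-∑ _ ts f ⟨
    ∑ ts f * ∑ us g                                     ∎

  elementary₀ : ∀ N → elementary N 0 ≈ 1#
  elementary₀ zero    = ≈-refl
  elementary₀ (suc N) = ≈-trans (+-cong (elementary₀ N) (zeroʳ _)) (+-identityʳ 1#)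

  elementary₁ : ∀ N → elementary N 1 ≈ ∑ (upTo N) (λ n → ξ (suc n))
  elementary₁ N = ≈-trans (ascending N) (≈-sym (∑-applyUpTo id N _))
    where
    ascending : ∀ N → elementary N 1 ≈ ∑< N (λ n → ξ (suc n))
    ascending zero    = ≈-refl
    ascending (suc N) = +-cong (ascending N) (≈-trans (*-cong ≈-refl (elementary₀ N)) (*-identityʳ _))

  -- The new term `ξ (suc N) * elementary N 1` expands into the layer of quadruples with y = N + 1
  -- and x between 1 and N.
  elementary₂ : ∀ N → elementary N 2 ≈ ∑ (quadruples M N) (λ t → cq^ (sign t) (size t))
  elementary₂ zero    = ≈-refl
  elementary₂ (suc N) = begin
    elementary N 2 + ξ (suc N) * elementary N 1
      ≈⟨ +-cong (elementary₂ N) (≈-trans (*-comm _ _) (*-cong (elementary₁ N) ≈-refl)) ⟩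
    ∑ (quadruples M N) F + ∑ (upTo N) (λ n → ξ (suc n)) * ξ (suc N)
      ≈⟨ +-cong ≈-refl (*-distribʳ-∑ _ (upTo N) _) ⟩
    ∑ (quadruples M N) F + ∑ (upTo N) (λ n → ξ (suc n) * ξ (suc N))
      ≈⟨ +-cong ≈-refl (∑-cong (upTo N) λ n → layer n) ⟨
    ∑ (quadruples M N) F + ∑ (upTo N) (λ n → ∑ signs (λ r → F (place N (n , r))))
      ≈⟨ +-cong ≈-refl (≈-trans (∑-map (place N) (cartesianProduct (upTo N) signs) F) (∑-cartesianProduct (upTo N) signs _)) ⟨
    ∑ (quadruples M N) F + ∑ (map (place N) (cartesianProduct (upTo N) signs)) F
      ≈⟨ ∑-++ (quadruples M N) _ F ⟨
    ∑ (quadruples M (suc N)) F ∎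
    where
    F : Quadruple → Carrier
    F t = cq^ (sign t) (size t)
    signs = cartesianProduct (upTo M) (upTo M)
    t : ℕ → ℕ → Carrier
    t n r = cq^ (-1ℤ ℤ.^ r) ((2 ℕ.* r ℕ.+ 1) ℕ.* n)
    layer : ∀ n → ∑ signs (λ r → F (place N (n , r))) ≈ ξ (suc n) * ξ (suc N)
    layer n = begin
      ∑ signs (λ r → F (place N (n , r)))
        ≈⟨ ∑-cong signs (λ (r₁ , r₂) → ≈-trans
             (≈-reflexive (cong (λ c → cq^ c (size (place N (n , r₁ , r₂)))) (ℤₚ.^-distribˡ-+-* -1ℤ r₁ r₂)))
             (cq^-* (-1ℤ ℤ.^ r₁) (-1ℤ ℤ.^ r₂) ((2 ℕ.* r₁ ℕ.+ 1) ℕ.* suc n) ((2 ℕ.* r₂ ℕ.+ 1) ℕ.* suc N))) ⟩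
      ∑ signs (λ (r₁ , r₂) → t (suc n) r₁ * t (suc N) r₂)
        ≈⟨ ∑-product (upTo M) (upTo M) (t (suc n)) (t (suc N)) ⟩
      ∑ (upTo M) (t (suc n)) * ∑ (upTo M) (t (suc N))
        ≈⟨ *-cong (∑-applyUpTo id M _) (∑-applyUpTo id M _) ⟩
      ξ (suc n) * ξ (suc N) ∎

  -- The generating function of pod as a product

  ∏≤-cong : ∀ N {f g} → (∀ k → f (suc k) ≈ g (suc k)) → ∏≤ N f ≈ ∏≤ N g
  ∏≤-cong zero    p = ≈-refl
  ∏≤-cong (suc N) p = *-cong (∏≤-cong N p) (p N)

  ∏≤-* : ∀ N f g → ∏≤ N (λ k → f k * g k) ≈ ∏≤ N f * ∏≤ N g
  ∏≤-* zero    f g = ≈-sym (*-identityˡ 1#)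
  ∏≤-* (suc N) f g = ≈-trans (*-cong (∏≤-* N f g) ≈-refl)
    (S.solve 4 (λ a b c d → (a S.:* b) S.:* (c S.:* d) S.:= (a S.:* c) S.:* (b S.:* d)) ≈-refl _ _ _ _)

  ∏≤-1 : ∀ N {f} → (∀ k → f (suc k) ≈ 1#) → ∏≤ N f ≈ 1#
  ∏≤-1 zero    p = ≈-refl
  ∏≤-1 (suc N) p = ≈-trans (*-cong (∏≤-1 N p) (p N)) (*-identityˡ 1#)

  ∏≤-trim : ∀ d N {f} → (∀ k → N < k → f k ≈ 1#) → ∏≤ (d ℕ.+ N) f ≈ ∏≤ N f
  ∏≤-trim zero    N p = ≈-refl
  ∏≤-trim (suc d) N p = ≈-trans (*-cong (∏≤-trim d N p) (p _ (s≤s (ℕₚ.m≤n+m N d)))) (*-identityʳ _)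

  ∏≤-pair : ∀ N f → ∏≤ (N ℕ.+ N) f ≈ ∏≤ N (λ i → f (ℕ.pred (i ℕ.+ i)) * f (i ℕ.+ i))
  ∏≤-pair zero    f = ≈-refl
  ∏≤-pair (suc N) f = begin
    ∏≤ (N ℕ.+ suc N) f * f (suc N ℕ.+ suc N)
      ≈⟨ *-cong (≈-reflexive (cong (λ n → ∏≤ n f) (ℕₚ.+-suc N N))) ≈-refl ⟩
    (∏≤ (N ℕ.+ N) f * f (suc (N ℕ.+ N))) * f (suc N ℕ.+ suc N)
      ≈⟨ *-cong (*-cong (∏≤-pair N f) (≈-reflexive (cong f (sym (ℕₚ.+-suc N N))))) ≈-refl ⟩
    (∏≤ N (λ i → f (ℕ.pred (i ℕ.+ i)) * f (i ℕ.+ i)) * f (N ℕ.+ suc N)) * f (suc N ℕ.+ suc N)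
      ≈⟨ *-assoc _ _ _ ⟩
    ∏≤ (suc N) (λ i → f (ℕ.pred (i ℕ.+ i)) * f (i ℕ.+ i)) ∎

  geometric : ℕ → ℕ → Carrier
  geometric m p = ∑< m (λ i → q^ (i ℕ.* p))

  geometric₂ : ∀ p → geometric 2 p ≈ 1# + q^ p
  geometric₂ p = +-cong (≈-trans (+-identityˡ _) cq^-1) (q^-≡ (ℕₚ.*-identityˡ p))

  geometric-inverse : ∀ k → 1-q^ (suc k) * geometric M (suc k) ≈ 1#
  geometric-inverse k = begin
    1-q^ (suc k) * geometric M (suc k)                       ≈⟨ +-identityʳ _ ⟨
    1-q^ (suc k) * geometric M (suc k) + 0#                  ≈⟨ +-cong ≈-refl (cq^-vanishes 1ℤ (ℕₚ.m≤m*n M (suc k))) ⟨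
    1-q^ (suc k) * geometric M (suc k) + q^ (M ℕ.* suc k)    ≈⟨ telescope M ⟩
    1#                                                       ∎
    where
    telescope : ∀ m → 1-q^ (suc k) * geometric m (suc k) + q^ (m ℕ.* suc k) ≈ 1#
    telescope zero    = ≈-trans (+-cong (zeroʳ _) cq^-1) (+-identityˡ 1#)
    telescope (suc m) = begin
      1-q^ (suc k) * (g + y) + q^ (suc k ℕ.+ m ℕ.* suc k)  ≈⟨ +-cong ≈-refl (q^-+ (suc k) (m ℕ.* suc k)) ⟩
      1-q^ (suc k) * (g + y) + q^ (suc k) * y
        ≈⟨ S.solve 3 (λ x g y → (S.con 1ℤ S.:- x) S.:* (g S.:+ y) S.:+ x S.:* y
             S.:= (S.con 1ℤ S.:- x) S.:* g S.:+ y) ≈-refl (q^ (suc k)) g y ⟩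
      1-q^ (suc k) * g + y                                 ≈⟨ telescope m ⟩
      1#                                                   ∎
      where
      g = geometric m (suc k)
      y = q^ (m ℕ.* suc k)

  copies : ℕ → Carrier
  copies p = geometric (maxCopies M p) p

  partitionsUpTo-product : ∀ k → ∑ (partitionsUpTo M k) (q^ ∘ sum) ≈ ∏≤ k copies
  partitionsUpTo-product zero    = ≈-trans (+-identityʳ _) cq^-1
  partitionsUpTo-product (suc k) = begin
    ∑ (map (prepend (suc k)) (cartesianProduct (upTo m) (partitionsUpTo M k))) (q^ ∘ sum)
      ≈⟨ ∑-map (prepend (suc k)) (cartesianProduct (upTo m) (partitionsUpTo M k)) _ ⟩
    ∑ (cartesianProduct (upTo m) (partitionsUpTo M k)) (q^ ∘ sum ∘ prepend (suc k))
      ≈⟨ ∑-cong (cartesianProduct (upTo m) (partitionsUpTo M k)) (λ (i , ps) →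
           ≈-trans (q^-≡ (sum-prepend (suc k) i ps)) (q^-+ (i ℕ.* suc k) (sum ps))) ⟩
    ∑ (cartesianProduct (upTo m) (partitionsUpTo M k)) (λ (i , ps) → q^ (i ℕ.* suc k) * q^ (sum ps))
      ≈⟨ ∑-product (upTo m) (partitionsUpTo M k) _ _ ⟩
    ∑ (upTo m) (λ i → q^ (i ℕ.* suc k)) * ∑ (partitionsUpTo M k) (q^ ∘ sum)
      ≈⟨ *-cong (∑-applyUpTo id m _) (partitionsUpTo-product k) ⟩
    copies (suc k) * ∏≤ k copies
      ≈⟨ *-comm _ _ ⟩
    ∏≤ (suc k) copies ∎
    where m = maxCopies M (suc k)

  copies-odd : ∀ k → copies (suc (k ℕ.+ k)) ≈ 1# + q^ (suc (k ℕ.+ k))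
  copies-odd k with odd? (suc (k ℕ.+ k))
  ... | yes _   = geometric₂ (suc (k ℕ.+ k))
  ... | no ¬odd = contradiction (odd-1+n+n k) ¬odd

  copies-even : ∀ k → copies (k ℕ.+ k) ≈ geometric M (k ℕ.+ k)
  copies-even k with odd? (k ℕ.+ k)
  ... | yes odd = contradiction (2∣n+n k) odd
  ... | no _    = ≈-refl

  -- The upper limit is even so that part sizes pair off as 2i - 1 and 2i. The factors 1 + q²ⁿ with
  -- n > N are trivial; those with n ≤ N are the even half of ∏ (1 + qⁿ), n ≤ 2N, whose odd half
  -- comes from the odd parts. The product with ∏ (1 - qⁿ) is ∏ (1 - q²ⁿ), again trivial beyond N,
  -- and the geometric series of the even parts invert it.
  partitions-denominator : ∀ N → M ≤ suc N → ∏≤ (N ℕ.+ N) copies * denominator (N ℕ.+ N) ≈ 1#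
  partitions-denominator N M≤1+N = begin
    ∏≤ N₂ copies * denominator N₂
      ≈⟨ *-cong (∏≤-pair N copies) (∏≤-* N₂ 1-q^ square) ⟩
    ∏≤ N (λ i → copies (ℕ.pred (i ℕ.+ i)) * copies (i ℕ.+ i)) * (∏≤ N₂ 1-q^ * ∏≤ N₂ square)
      ≈⟨ *-cong (≈-trans (∏≤-cong N split) (∏≤-* N (1+ ∘ odd) (g ∘ even)))
           (*-cong ≈-refl (≈-trans (∏≤-trim N N λ k N<k → ≈-trans (square≈ k) (1+-trivial (far k N<k)))
             (∏≤-cong N λ k → square≈ (suc k)))) ⟩
    (∏≤ N (1+ ∘ odd) * ∏≤ N (g ∘ even)) * (∏≤ N₂ 1-q^ * ∏≤ N (1+ ∘ even))
      ≈⟨ S.solve 4 (λ a b c d → (a S.:* b) S.:* (c S.:* d) S.:= (c S.:* (a S.:* d)) S.:* b) ≈-refl _ _ _ _ ⟩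
    (∏≤ N₂ 1-q^ * (∏≤ N (1+ ∘ odd) * ∏≤ N (1+ ∘ even))) * ∏≤ N (g ∘ even)
      ≈⟨ *-cong (*-cong ≈-refl (≈-trans (∏≤-pair N 1+) (∏≤-* N (1+ ∘ odd) (1+ ∘ even)))) ≈-refl ⟨
    (∏≤ N₂ 1-q^ * ∏≤ N₂ 1+) * ∏≤ N (g ∘ even)
      ≈⟨ *-cong (∏≤-* N₂ 1-q^ 1+) ≈-refl ⟨
    ∏≤ N₂ (λ k → 1-q^ k * 1+ k) * ∏≤ N (g ∘ even)
      ≈⟨ *-cong (≈-trans (∏≤-cong N₂ λ k → difference (suc k))
           (∏≤-trim N N λ k N<k → 1-trivial (far k N<k))) ≈-refl ⟩
    ∏≤ N (1-q^ ∘ even) * ∏≤ N (g ∘ even)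
      ≈⟨ ∏≤-* N (1-q^ ∘ even) (g ∘ even) ⟨
    ∏≤ N (λ i → 1-q^ (even i) * g (even i))
      ≈⟨ ∏≤-1 N (λ k → geometric-inverse (k ℕ.+ suc k)) ⟩
    1# ∎
    where
    N₂ = N ℕ.+ N
    odd even : ℕ → ℕ
    odd i = ℕ.pred (i ℕ.+ i)
    even i = i ℕ.+ i
    1+ square g : ℕ → Carrier
    1+ k = 1# + q^ k
    square k = 1# + q^ k * q^ k
    g = geometric M
    square≈ : ∀ k → square k ≈ 1+ (even k)
    square≈ k = +-cong ≈-refl (≈-sym (q^-+ k k))
    split : ∀ k → copies (odd (suc k)) * copies (even (suc k)) ≈ 1+ (odd (suc k)) * g (even (suc k))
    split k = *-cong (subst (λ n → copies n ≈ 1+ n) (sym (ℕₚ.+-suc k k)) (copies-odd k)) (copies-even (suc k))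
    difference : ∀ k → 1-q^ k * 1+ k ≈ 1-q^ (even k)
    difference k = ≈-trans
      (S.solve 1 (λ x → (S.con 1ℤ S.:- x) S.:* (S.con 1ℤ S.:+ x) S.:= S.con 1ℤ S.:- x S.:* x) ≈-refl (q^ k))
      (+-cong ≈-refl (-‿cong (≈-sym (q^-+ k k))))
    far : ∀ k → N < k → M ≤ even k
    far k N<k = ℕₚ.≤-trans M≤1+N (ℕₚ.≤-trans N<k (ℕₚ.m≤m+n k k))
    1+-trivial : ∀ {e} → M ≤ e → 1+ e ≈ 1#
    1+-trivial M≤e = ≈-trans (+-cong ≈-refl (cq^-vanishes 1ℤ M≤e)) (+-identityʳ 1#)
    1-trivial : ∀ {e} → M ≤ e → 1-q^ e ≈ 1#
    1-trivial M≤e = ≈-trans (+-cong ≈-refl (-‿cong (cq^-vanishes 1ℤ M≤e)))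
      (S.solve 0 (S.con 1ℤ S.:- S.con 0ℤ S.:= S.con 1ℤ) ≈-refl)

  -- The identity modulo q^M

  theta-S : ∀ n → ∑< (suc (suc n)) (λ k → cq^ (V-coeff k 2) (tri k)) ≈
            ∑ (map suc (upTo n)) (λ r → cq^ (S-coefficient r) (T (r ℕ.+ 1)))
  theta-S n = begin
    ∑< (suc (suc n)) f
      -- V₀ and V₁ have no z²-term, so the sum starts at k = 2, which is r = k - 1 = 1.
      ≈⟨ ≈-trans (∑<-bottom (suc n) f) (+-cong (cq^-0 0) (≈-trans (∑<-bottom n (f ∘ suc)) (+-cong (cq^-0 1) ≈-refl))) ⟩
    0# + (0# + ∑< n (f ∘ suc ∘ suc))
      ≈⟨ ≈-trans (+-identityˡ _) (+-identityˡ _) ⟩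
    ∑< n (f ∘ suc ∘ suc)
      ≈⟨ ∑<-cong n (λ k _ → ≈-reflexive (cong₂ cq^ (coefficient k) (exponent k))) ⟩
    ∑< n (F ∘ suc)
      ≈⟨ ≈-trans (∑-map suc (upTo n) F) (∑-applyUpTo id n (F ∘ suc)) ⟨
    ∑ (map suc (upTo n)) F ∎
    where
    f F : ℕ → Carrier
    f k = cq^ (V-coeff k 2) (tri k)
    F r = cq^ (S-coefficient r) (T (r ℕ.+ 1))
    coefficient : ∀ k → V-coeff (suc (suc k)) 2 ≡ S-coefficient (suc k)
    coefficient k = trans (V-coeff₂ k)
      (sym (cong₂ (λ s t → -1ℤ ℤ.^ s ℤ.* + t) (T≡tri k) (T≡tri ⌈ suc k /2⌉)))
    exponent : ∀ k → tri (suc (suc k)) ≡ T (suc k ℕ.+ 1)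
    exponent k = trans (sym (T≡tri (suc (suc k)))) (cong T (ℕₚ.+-comm 1 (suc k)))

  -- Even, for the pairing of odd and even part sizes, and larger than M. The two successors make
  -- `suc bound` the range in `theta-S` at n = `M ℕ.+ suc M`.
  bound : ℕ
  bound = suc M ℕ.+ suc M

  factorization :
    ∑ (quadruples M bound) (λ t → cq^ (sign t) (size t)) ≈
    ∑ (partitionsUpTo M bound) (q^ ∘ sum) *
    ∑ (map suc (upTo (M ℕ.+ suc M))) (λ r → cq^ (S-coefficient r) (T (r ℕ.+ 1)))
  factorization = begin
    ∑ (quadruples M bound) (λ t → cq^ (sign t) (size t))
      ≈⟨ elementary₂ bound ⟨
    elementary bound 2
      ≈⟨ *-identityˡ _ ⟨
    1# * elementary bound 2
      ≈⟨ *-cong (partitions-denominator (suc M) (ℕₚ.m≤n⇒m≤1+n (ℕₚ.n≤1+n M))) ≈-refl ⟨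
    (∏≤ bound copies * denominator bound) * elementary bound 2
      ≈⟨ *-assoc _ _ _ ⟩
    ∏≤ bound copies * (denominator bound * elementary bound 2)
      ≈⟨ *-cong (partitionsUpTo-product bound) (≈-trans
           (≈-sym (theta-S (M ℕ.+ suc M)))
           (≈-trans (≈-sym (thetaProduct-limit bound 2 M≤1+bound)) (thetaProduct-elementary bound 2))) ⟨
    ∑ (partitionsUpTo M bound) (q^ ∘ sum) *
    ∑ (map suc (upTo (M ℕ.+ suc M))) (λ r → cq^ (S-coefficient r) (T (r ℕ.+ 1))) ∎
    where
    M≤1+bound : M ≤ suc bound
    M≤1+bound = ℕₚ.m≤n⇒m≤1+n (ℕₚ.m≤n⇒m≤1+n (ℕₚ.m≤m+n M (suc M)))

-- Comparison of the enumerations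

sumℤ-↭ : ∀ {xs ys} → xs ↭ ys → sumℤ xs ≡ sumℤ ys
sumℤ-↭ Perm.refl = refl
sumℤ-↭ (Perm.prep x p) = cong (λ s → x ℤ.+ s) (sumℤ-↭ p)
sumℤ-↭ (Perm.swap {xs} {ys} x y p) = trans (cong (λ s → x ℤ.+ (y ℤ.+ s)) (sumℤ-↭ p))
  (solve 3 (λ x y s → x :+ (y :+ s) := y :+ (x :+ s)) refl x y (sumℤ ys))
  where open +-*-Solver
sumℤ-↭ (Perm.trans p r) = trans (sumℤ-↭ p) (sumℤ-↭ r)

-- Duplicate-free lists with the same members are permutations of each other. Each layered
-- enumeration is matched with the one in the definitions in this way.
sumℤ-same-elements : ∀ {X : Set} (c : X → ℤ) {ts us} → Unique ts → Unique us →
  (∀ {t} → t ∈ ts → t ∈ us) → (∀ {t} → t ∈ us → t ∈ ts) → sumℤ (map c ts) ≡ sumℤ (map c us)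
sumℤ-same-elements c ts! us! ts⊆us us⊆ts =
  sumℤ-↭ (↭-map⁺ c (∼bag⇒↭ (unique∧set⇒bag ts! us! (mk⇔ ts⊆us us⊆ts))))

sumℤ-ones : ∀ {X : Set} (ts : List X) → sumℤ (map (λ _ → 1ℤ) ts) ≡ + length ts
sumℤ-ones []       = refl
sumℤ-ones (t ∷ ts) = cong (λ s → 1ℤ ℤ.+ s) (sumℤ-ones ts)

-- Injectivity is asked only on members of the list: `prepend (suc k)` is injective only when the
-- remaining parts are at most k.
unique-map : ∀ {X Y : Set} {f : X → Y} {ts} →
  (∀ {t u} → t ∈ ts → u ∈ ts → f t ≡ f u → t ≡ u) → Unique ts → Unique (map f ts)
unique-map inj []          = []
unique-map {f = f} inj (t≢ts ∷ ts!) =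
  Allₚ.map⁺ (All.tabulate λ u∈ts ft≡fu → All.lookup t≢ts u∈ts (inj (here refl) (there u∈ts) ft≡fu))
  ∷ unique-map (λ t∈ u∈ → inj (there t∈) (there u∈)) ts!

Bounded : ℕ → ℕ → Quadruple → Set
Bounded M N (x , y , r₁ , r₂) = 1 ≤ x × x < y × y ≤ N × r₁ < M × r₂ < M

∈-quadruples⁻ : ∀ M N {t} → t ∈ quadruples M N → Bounded M N t
∈-quadruples⁻ M (suc N) t∈ with ∈-++⁻ (quadruples M N) t∈
... | inj₁ t∈′ with 1≤x , x<y , y≤N , r₁<M , r₂<M ← ∈-quadruples⁻ M N t∈′ =
  1≤x , x<y , ℕₚ.m≤n⇒m≤1+n y≤N , r₁<M , r₂<M
... | inj₂ t∈′ with ∈-map⁻ (place N) t∈′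
... | _ , u∈ , refl with x∈ , r∈ ← ∈-cartesianProduct⁻ (upTo N) _ u∈
  with r₁∈ , r₂∈ ← ∈-cartesianProduct⁻ (upTo M) (upTo M) r∈ =
  s≤s z≤n , s≤s (∈-upTo⁻ x∈) , ℕₚ.≤-refl , ∈-upTo⁻ r₁∈ , ∈-upTo⁻ r₂∈

∈-quadruples⁺ : ∀ M N {t} → Bounded M N t → t ∈ quadruples M N
∈-quadruples⁺ M zero    (_ , x<y , y≤0 , _) = contradiction (ℕₚ.<-≤-trans x<y y≤0) λ ()
∈-quadruples⁺ M (suc N) {suc x , y , r₁ , r₂} (1≤x , x<y , y≤1+N , r₁<M , r₂<M) with y ℕₚ.≤? N
... | yes y≤N = ∈-++⁺ˡ (∈-quadruples⁺ M N (1≤x , x<y , y≤N , r₁<M , r₂<M))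
... | no  y≰N with refl ← ℕₚ.≤-antisym y≤1+N (ℕₚ.≰⇒> y≰N) =
  ∈-++⁺ʳ (quadruples M N) (∈-map⁺ (place N) (∈-cartesianProduct⁺ (∈-upTo⁺ (ℕₚ.≤-pred x<y))
    (∈-cartesianProduct⁺ (∈-upTo⁺ r₁<M) (∈-upTo⁺ r₂<M))))

quadruples-unique : ∀ M N → Unique (quadruples M N)
quadruples-unique M zero    = []
quadruples-unique M (suc N) = Uniqueₚ.++⁺ (quadruples-unique M N)
  (Uniqueₚ.map⁺ (λ { refl → refl }) (Uniqueₚ.cartesianProduct⁺ (Uniqueₚ.upTo⁺ N)
    (Uniqueₚ.cartesianProduct⁺ (Uniqueₚ.upTo⁺ M) (Uniqueₚ.upTo⁺ M))))
  disjoint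
  where
  disjoint : Disjoint (quadruples M N) (map (place N) (cartesianProduct (upTo N) (cartesianProduct (upTo M) (upTo M))))
  disjoint (t∈ , t∈′) with ∈-map⁻ (place N) t∈′
  ... | _ , _ , refl with _ , _ , 1+N≤N , _ ← ∈-quadruples⁻ M N t∈ = ℕₚ.<-irrefl refl 1+N≤N

-- Every solution lies in `box n`, whose entries are at most n < M.
solutions-bounded : ∀ {n M t} → n < M → IsSolution n t → Bounded M (suc M ℕ.+ suc M) t
solutions-bounded {n} {M} {t@(x , y , r₁ , r₂)} n<M s@(1≤x , x<y , _)
  with t∈box , _ ← ∈-filter⁻ (isSolution? n) {xs = box n} (Equivalence.from (∈-solutions n t) s)
  with _ , t∈′ ← ∈-cartesianProduct⁻ (upTo (suc n)) _ t∈box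
  with y∈ , r∈ ← ∈-cartesianProduct⁻ (upTo (suc n)) _ t∈′
  with r₁∈ , r₂∈ ← ∈-cartesianProduct⁻ (upTo (suc n)) (upTo (suc n)) r∈ =
  1≤x , x<y ,
  ℕₚ.≤-trans (ℕₚ.<⇒≤ (small y∈)) (ℕₚ.≤-trans (ℕₚ.n≤1+n M) (ℕₚ.m≤m+n (suc M) (suc M))) ,
  small r₁∈ , small r₂∈
  where
  small : ∀ {i} → i ∈ upTo (suc n) → i < M
  small i∈ = ℕₚ.<-≤-trans (∈-upTo⁻ i∈) n<M

quadruples-sum : ∀ {n M} → n < M →
  sumℤ (map sign (filter (λ t → size t ℕₚ.≟ n) (quadruples M (suc M ℕ.+ suc M)))) ≡ a n
quadruples-sum {n} {M} n<M = sumℤ-same-elements sign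
  (Uniqueₚ.filter⁺ (λ t → size t ℕₚ.≟ n) (quadruples-unique M K)) (solutions-unique n) to from
  where
  K = suc M ℕ.+ suc M
  to : ∀ {t} → t ∈ filter (λ t → size t ℕₚ.≟ n) (quadruples M K) → t ∈ solutions n
  to {t} t∈ with t∈′ , size≡n ← ∈-filter⁻ (λ t → size t ℕₚ.≟ n) {xs = quadruples M K} t∈
    with 1≤x , x<y , _ ← ∈-quadruples⁻ M K t∈′ = Equivalence.from (∈-solutions n t) (1≤x , x<y , size≡n)
  from : ∀ {t} → t ∈ solutions n → t ∈ filter (λ t → size t ℕₚ.≟ n) (quadruples M K)
  from {t} t∈ with s ← Equivalence.to (∈-solutions n t) t∈ =
    ∈-filter⁺ (λ t → size t ℕₚ.≟ n) (∈-quadruples⁺ M K (solutions-bounded n<M s)) (proj₂ (proj₂ s))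

indices-sum : ∀ {n M} → n < M →
  sumℤ (map S-coefficient (filter (λ r → T (r ℕ.+ 1) ℕₚ.≟ n) (map suc (upTo (M ℕ.+ suc M))))) ≡ S n
indices-sum {n} {M} n<M = sumℤ-same-elements S-coefficient
  (Uniqueₚ.filter⁺ (λ r → T (r ℕ.+ 1) ℕₚ.≟ n) (Uniqueₚ.map⁺ ℕₚ.suc-injective (Uniqueₚ.upTo⁺ (M ℕ.+ suc M)))) (indices-unique n) to from
  where
  to : ∀ {r} → r ∈ filter (λ r → T (r ℕ.+ 1) ℕₚ.≟ n) (map suc (upTo (M ℕ.+ suc M))) → r ∈ indices n
  to {r} r∈ with r∈′ , eq ← ∈-filter⁻ (λ r → T (r ℕ.+ 1) ℕₚ.≟ n) {xs = map suc (upTo (M ℕ.+ suc M))} r∈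
    with _ , _ , refl ← ∈-map⁻ suc r∈′ = Equivalence.from (∈-indices n r) (s≤s z≤n , eq)
  from : ∀ {r} → r ∈ indices n → r ∈ filter (λ r → T (r ℕ.+ 1) ℕₚ.≟ n) (map suc (upTo (M ℕ.+ suc M)))
  from {r} r∈ with r∈′ , eq ← ∈-filter⁻ (λ r → T (r ℕ.+ 1) ℕₚ.≟ n) {xs = map suc (upTo n)} r∈
    with _ , i∈ , refl ← ∈-map⁻ suc r∈′ = ∈-filter⁺ (λ r → T (r ℕ.+ 1) ℕₚ.≟ n)
      (∈-map⁺ suc (∈-upTo⁺ (ℕₚ.<-≤-trans (∈-upTo⁻ i∈) (ℕₚ.≤-trans (ℕₚ.<⇒≤ n<M) (ℕₚ.m≤m+n M (suc M)))))) eq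

-- Partitions with distinct odd parts

record PodUpTo (k : ℕ) (ps : List ℕ) : Set where
  constructor podUpTo
  field
    descending  : Linked _≥_ ps
    positive    : All (1 ≤_) ps
    parts≤      : All (_≤ k) ps
    oddDistinct : OddPartsDistinct ps

cons-descending : ∀ {p ps} → All (_≤ p) ps → Linked _≥_ ps → Linked _≥_ (p ∷ ps)
cons-descending []        []  = [-]
cons-descending (q≤p ∷ _) ps≥ = q≤p ∷ ps≥

cons-even : ∀ {p ps} → ¬ Odd p → OddPartsDistinct ps → OddPartsDistinct (p ∷ ps)
cons-even ¬odd = subst Unique (sym (filter-reject odd? ¬odd))

cons-new : ∀ {p ps} → All (_< p) ps → OddPartsDistinct ps → OddPartsDistinct (p ∷ ps)
cons-new {p} {ps} ps<p ps! with odd? p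
... | yes odd = subst Unique (sym (filter-accept odd? odd))
  (Allₚ.filter⁺ odd? (All.map (λ q<p p≡q → ℕₚ.<-irrefl (sym p≡q) q<p) ps<p) ∷ ps!)
... | no ¬odd = cons-even ¬odd ps!

tail-oddDistinct : ∀ p {ps} → OddPartsDistinct (p ∷ ps) → OddPartsDistinct ps
tail-oddDistinct p ps! with odd? p
... | no ¬odd = subst Unique (filter-reject odd? ¬odd) ps!
... | yes odd with _ ∷ ps!′ ← subst Unique (filter-accept odd? odd) ps! = ps!′

twice-odd : ∀ {p ps} → Odd p → ¬ OddPartsDistinct (p ∷ p ∷ ps)
twice-odd {p} {ps} odd ps! with (p≢p ∷ _) ∷ _ ← subst Unique
  (trans (filter-accept odd? {xs = p ∷ ps} odd) (cong (p ∷_) (filter-accept odd? {xs = ps} odd))) ps! = p≢p refl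

cons-pod : ∀ {k ps} → OddPartsDistinct (suc k ∷ ps) → PodUpTo (suc k) ps → PodUpTo (suc k) (suc k ∷ ps)
cons-pod distinct (podUpTo desc pos ps≤ _) =
  podUpTo (cons-descending ps≤ desc) (s≤s z≤n ∷ pos) (ℕₚ.≤-refl ∷ ps≤) distinct

relax-pod : ∀ {k ps} → PodUpTo k ps → PodUpTo (suc k) ps
relax-pod (podUpTo desc pos ps≤ distinct) = podUpTo desc pos (All.map ℕₚ.m≤n⇒m≤1+n ps≤) distinct

prepend-pod : ∀ {M k ps} m → m < maxCopies M (suc k) → PodUpTo k ps → PodUpTo (suc k) (prepend (suc k) (m , ps))
prepend-pod {k = k} m m< pod with odd? (suc k)
prepend-pod zero          _              pod | yes _ = relax-pod pod
prepend-pod (suc zero)    _              pod | yes _ =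
  cons-pod (cons-new (All.map s≤s (PodUpTo.parts≤ pod)) (PodUpTo.oddDistinct pod)) (relax-pod pod)
prepend-pod (suc (suc m)) (s≤s (s≤s ())) pod | yes _
prepend-pod {k = k} {ps} m _             pod | no ¬odd = even-copies m
  where
  even-copies : ∀ m → PodUpTo (suc k) (prepend (suc k) (m , ps))
  even-copies zero    = relax-pod pod
  even-copies (suc m) = cons-pod (cons-even ¬odd (PodUpTo.oddDistinct (even-copies m))) (even-copies m)

∈-partitionsUpTo⁻ : ∀ M k {ps} → ps ∈ partitionsUpTo M k → PodUpTo k ps
∈-partitionsUpTo⁻ M zero    (here refl) = podUpTo [] [] [] []
∈-partitionsUpTo⁻ M (suc k) ps∈ with ∈-map⁻ (prepend (suc k)) ps∈
... | (m , qs) , mqs∈ , refl with m∈ , qs∈ ← ∈-cartesianProduct⁻ (upTo (maxCopies M (suc k))) _ mqs∈ =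
  prepend-pod {M} m (∈-upTo⁻ m∈) (∈-partitionsUpTo⁻ M k qs∈)

tail-pod : ∀ {k p ps} → PodUpTo k (p ∷ ps) → PodUpTo k ps
tail-pod {p = p} (podUpTo desc (_ ∷ pos) (_ ∷ ps≤) distinct) =
  podUpTo (Linked.tail desc) pos ps≤ (tail-oddDistinct p distinct)

descending-bounded : ∀ {b p ps} → p ≤ b → Linked _≥_ (p ∷ ps) → All (_≤ b) (p ∷ ps)
descending-bounded p≤b [-]         = p≤b ∷ []
descending-bounded p≤b (q≤p ∷ ps≥) = p≤b ∷ descending-bounded (ℕₚ.≤-trans q≤p p≤b) ps≥

-- In a descending list the copies of k + 1 form a prefix: a head of at most k bounds everything
-- after it.
split-largest : ∀ k ps → PodUpTo (suc k) ps → ∃₂ λ m qs → ps ≡ prepend (suc k) (m , qs) × PodUpTo k qs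
split-largest k []       (podUpTo _ _ _ distinct) = 0 , [] , refl , podUpTo [] [] [] distinct
split-largest k (p ∷ ps) pod@(podUpTo desc pos (p≤1+k ∷ _) distinct) with p ℕₚ.≤? k
... | yes p≤k = 0 , p ∷ ps , refl , podUpTo desc pos (descending-bounded p≤k desc) distinct
... | no  p≰k with refl ← ℕₚ.≤-antisym p≤1+k (ℕₚ.≰⇒> p≰k)
  with m , qs , refl , qs-pod ← split-largest k ps (tail-pod pod) = suc m , qs , refl , qs-pod

-- Two copies of an odd part contradict distinctness; for an even part, m ≤ m (k + 1) ≤ sum < M.
copies<maxCopies : ∀ {M k} m qs → OddPartsDistinct (prepend (suc k) (m , qs)) →
  sum (prepend (suc k) (m , qs)) < M → m < maxCopies M (suc k)
copies<maxCopies {M} {k} m qs distinct sum<M with odd? (suc k)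
... | no _ = ℕₚ.≤-<-trans (ℕₚ.≤-trans (ℕₚ.m≤m*n m (suc k))
    (subst (m ℕ.* suc k ≤_) (sym (sum-prepend (suc k) m qs)) (ℕₚ.m≤m+n _ (sum qs)))) sum<M
copies<maxCopies zero          qs distinct _ | yes odd = s≤s z≤n
copies<maxCopies (suc zero)    qs distinct _ | yes odd = s≤s (s≤s z≤n)
copies<maxCopies {k = k} (suc (suc m)) qs distinct _ | yes odd =
  contradiction distinct (twice-odd {ps = prepend (suc k) (m , qs)} odd)

∈-partitionsUpTo⁺ : ∀ M k {ps} → PodUpTo k ps → sum ps < M → ps ∈ partitionsUpTo M k
∈-partitionsUpTo⁺ M zero {[]}    _ _ = here refl
∈-partitionsUpTo⁺ M zero {_ ∷ _} (podUpTo _ (1≤p ∷ _) (p≤0 ∷ _) _) _ = contradiction (ℕₚ.≤-trans 1≤p p≤0) λ ()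
∈-partitionsUpTo⁺ M (suc k) {ps} pod sum<M with m , qs , refl , qs-pod ← split-largest k ps pod =
  ∈-map⁺ (prepend (suc k)) (∈-cartesianProduct⁺
    (∈-upTo⁺ (copies<maxCopies m qs (PodUpTo.oddDistinct pod) sum<M))
    (∈-partitionsUpTo⁺ M k qs-pod (ℕₚ.≤-<-trans
      (subst (sum qs ≤_) (sym (sum-prepend (suc k) m qs)) (ℕₚ.m≤n+m (sum qs) _)) sum<M)))

-- Since the remaining parts are at most k, the copies of k + 1 can be counted off from the front.
prepend-injective : ∀ {k} m m′ {qs qs′} → All (_≤ k) qs → All (_≤ k) qs′ →
  prepend (suc k) (m , qs) ≡ prepend (suc k) (m′ , qs′) → (m , qs) ≡ (m′ , qs′)
prepend-injective zero    zero     _       _        refl = refl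
prepend-injective zero    (suc m′) (p ∷ _) _        refl = contradiction p (ℕₚ.<-irrefl refl)
prepend-injective (suc m) zero     _       (p ∷ _)  refl = contradiction p (ℕₚ.<-irrefl refl)
prepend-injective (suc m) (suc m′) qs≤     qs′≤     eq
  with refl ← prepend-injective m m′ qs≤ qs′≤ (∷-injectiveʳ eq) = refl

partitionsUpTo-unique : ∀ M k → Unique (partitionsUpTo M k)
partitionsUpTo-unique M zero    = [] ∷ []
partitionsUpTo-unique M (suc k) = unique-map injective
  (Uniqueₚ.cartesianProduct⁺ (Uniqueₚ.upTo⁺ (maxCopies M (suc k))) (partitionsUpTo-unique M k))
  where
  bounded : ∀ {m qs} → (m , qs) ∈ cartesianProduct (upTo (maxCopies M (suc k))) (partitionsUpTo M k) → All (_≤ k) qs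
  bounded mqs∈ = PodUpTo.parts≤ (∈-partitionsUpTo⁻ M k (proj₂ (∈-cartesianProduct⁻ (upTo (maxCopies M (suc k))) _ mqs∈)))
  injective : ∀ {t u} → t ∈ cartesianProduct (upTo (maxCopies M (suc k))) (partitionsUpTo M k) →
    u ∈ cartesianProduct (upTo (maxCopies M (suc k))) (partitionsUpTo M k) →
    prepend (suc k) t ≡ prepend (suc k) u → t ≡ u
  injective {m , _} {m′ , _} t∈ u∈ = prepend-injective m m′ (bounded t∈) (bounded u∈)

part≤sum : ∀ ps → All (_≤ sum ps) ps
part≤sum []       = []
part≤sum (p ∷ ps) = ℕₚ.m≤m+n p _ ∷ All.map (λ q≤ → ℕₚ.≤-trans q≤ (ℕₚ.m≤n+m _ p)) (part≤sum ps)

partitions-sum : ∀ {n M} → n < M →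
  sumℤ (map (λ _ → 1ℤ) (filter (λ ps → sum ps ℕₚ.≟ n) (partitionsUpTo M (suc M ℕ.+ suc M)))) ≡ P n
partitions-sum {n} {M} n<M = trans (sumℤ-same-elements (λ _ → 1ℤ)
  (Uniqueₚ.filter⁺ (λ ps → sum ps ℕₚ.≟ n) (partitionsUpTo-unique M K)) (podPartitions-unique n) to from)
  (sumℤ-ones (podPartitions n))
  where
  K = suc M ℕ.+ suc M
  to : ∀ {ps} → ps ∈ filter (λ ps → sum ps ℕₚ.≟ n) (partitionsUpTo M K) → ps ∈ podPartitions n
  to {ps} ps∈ with ps∈′ , sum≡n ← ∈-filter⁻ (λ ps → sum ps ℕₚ.≟ n) {xs = partitionsUpTo M K} ps∈
    with podUpTo desc pos _ distinct ← ∈-partitionsUpTo⁻ M K ps∈′ =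
    Equivalence.from (∈-podPartitions n ps) ((desc , pos , sum≡n) , distinct)
  from : ∀ {ps} → ps ∈ podPartitions n → ps ∈ filter (λ ps → sum ps ℕₚ.≟ n) (partitionsUpTo M K)
  from {ps} ps∈ with (desc , pos , refl) , distinct ← Equivalence.to (∈-podPartitions n ps) ps∈ =
    ∈-filter⁺ (λ ps → sum ps ℕₚ.≟ n) (∈-partitionsUpTo⁺ M K
      (podUpTo desc pos (All.map (λ p≤ → ℕₚ.≤-trans p≤ n≤K) (part≤sum ps)) distinct) n<M) refl
    where
    n≤K : n ≤ K
    n≤K = ℕₚ.≤-trans (ℕₚ.<⇒≤ n<M) (ℕₚ.≤-trans (ℕₚ.n≤1+n M) (ℕₚ.m≤m+n (suc M) (suc M)))

-- Coefficients of the truncated identity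

module _ (M : ℕ) where

  open Truncated M
  open Identities monomialRing

  ∑-coefficient : ∀ {X : Set} (c : X → ℤ) (w : X → ℕ) ts n →
    ∑ ts (λ t → monomial (c t) (w t)) n ≡ sumℤ (map c (filter (λ t → w t ℕₚ.≟ n) ts))
  ∑-coefficient c w []       n = refl
  ∑-coefficient c w (t ∷ ts) n with w t ℕₚ.≟ n
  ... | yes wt≡n = trans
    (cong₂ ℤ._+_ (trans (cong (monomial (c t) (w t)) (sym wt≡n)) (monomial-at (c t) (w t))) (∑-coefficient c w ts n))
    (cong (sumℤ ∘ map c) (sym (filter-accept (λ t → w t ℕₚ.≟ n) wt≡n)))
  ... | no wt≢n  = trans
    (trans (cong₂ ℤ._+_ (monomial-off (c t) wt≢n) (∑-coefficient c w ts n)) (ℤₚ.+-identityˡ _))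
    (cong (sumℤ ∘ map c) (sym (filter-reject (λ t → w t ℕₚ.≟ n) wt≢n)))

  a-factorization : ∀ n → n < M → a n ≡ (P ⊛ S) n
  a-factorization n n<M = begin
    a n  ≡⟨ quadruples-sum n<M ⟨
    _    ≡⟨ ∑-coefficient sign size (quadruples M bound) n ⟨
    _    ≡⟨ coefficients factorization n n<M ⟩
    -- The factors agree with `P` and `S` only below M, which suffices because the coefficient at n
    -- < M involves no higher ones.
    _    ≡⟨ ⊛-cong-≤ n
              (λ i i≤n → trans (∑-coefficient (λ _ → 1ℤ) sum (partitionsUpTo M bound) i) (partitions-sum (ℕₚ.≤-<-trans i≤n n<M)))
              (λ i i≤n → trans (∑-coefficient S-coefficient (λ r → T (r ℕ.+ 1)) (map suc (upTo (M ℕ.+ suc M))) i) (indices-sum (ℕₚ.≤-<-trans i≤n n<M))) ⟩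
    (P ⊛ S) n ∎
    where open ≡-Reasoning

theorem1p3 : A ≗ P ⊛ S
-- `A 0` is 0 by definition and `a 0` evaluates to it: the only quadruple in `box 0` has x = 0. The
-- modulus is always M = n + 1, the least that sees the coefficient of qⁿ.
theorem1p3 zero    = a-factorization 1 0 (s≤s z≤n)
theorem1p3 (suc n) = a-factorization (suc (suc n)) (suc n) ℕₚ.≤-refl
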